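{- Let $\Phi$ be a finite irreducible crystallographic root system with simple system $\Pi$, let $S\subseteq\Pi$, and let $\beta\in\Phi^+$ with $\mathrm{Supp}(\beta)\cap S\ne\emptyset$. (1) $\Phi_{S,\mathbb Z\beta}$ is a root subsystem of $\Phi$. (2) $\Phi_{S,\beta}$ is an interval of the root poset, i.e. it has a minimum and a maximum and contains every root in between. Moreover, both $$\{\min\Phi_{S,\beta}\}\cup(\Pi\setminus S)\quad\text{and}\quad\{ -\max\Phi_{S,\beta}\}\cup(\Pi\setminus S)$$ are simple systems of $\Phi_{S,\mathbb Z\beta}$; in particular, $\min\Phi_{S,\beta}$ and $\max\Phi_{S,\beta}$ have the same length. (3) Let $\Psi=\Phi_{S,\mathbb Z\beta}$ and choose $\{\gamma\}\cup(\Pi\setminus S)$ as a set of simple roots of $\Psi$, where either $\gamma=\min\Phi_{S,\beta}$ or $\gamma=-\max\Phi_{S,\beta}$. Then $\Phi_{S,\beta}=\Psi_{\{\gamma\},\gamma}$ if $\gamma=\min\Phi_{S,\beta}$, and $\Phi_{S,\beta}=-\Psi_{\{\gamma\},\gamma}$ if $\gamma=-\max\Phi_{S,\beta}$.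
   Context: $\Phi$ is reduced, in a Euclidean space $\mathbb E=\mathrm{Span}_{\mathbb R}\Phi$ with Weyl-group-invariant form; $\Phi^+$ is the set of positive roots with respect to $\Pi$. Each root $\gamma$ is written $\gamma=\sum_{\alpha\in\Pi}c_\alpha(\gamma)\alpha$; $\mathrm{Supp}(\gamma)=\{\alpha\in\Pi:c_\alpha(\gamma)\ne0\}$. Define $$\Phi_{S,\beta}=\{\gamma\in\Phi:c_\alpha(\gamma)=c_\alpha(\beta)\ \forall\alpha\in S\},$$ $$\Phi_{S,\mathbb Z\beta}=\{\gamma\in\Phi:\exists k\in\mathbb Z\text{ with }c_\alpha(\gamma)=k\,c_\alpha(\beta)\ \forall\alpha\in S\}.$$ The root poset is $\Phi^+$ with $\alpha\le\beta$ iff $\beta-\alpha$ is a nonnegative linear combination of positive roots. For a root system $\Psi$ with simple system containing $\gamma$, $\Psi_{\{\gamma\},\gamma}$ is defined by the same recipe with respect to that simple system: it is the set of roots of $\Psi$ whose $\gamma$-coordinate is $1$. -}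

module Defs where

open import Level using (Level; _⊔_; suc)
open import Algebra.Bundles using (CommutativeRing)
open import Algebra.Module.Bundles using (Module)
import Algebra.Properties.CommutativeMonoid.Sum as Sum
import Algebra.Properties.Monoid.Mult as Mult
open import Data.Fin.Base using (Fin)
open import Data.Fin.Subset using (Subset) renaming (_∈_ to _∈ˢ_)
open import Data.Fin.Subset.Properties using () renaming (_∈?_ to _∈ˢ?_)
open import Data.Integer.Base using (ℤ; +_; -[1+_])
open import Data.List.Base using (List; allFin; filter; length; map)
import Data.List.Membership.Setoid as Membership
open import Data.Nat.Base using (ℕ) renaming (suc to 1+_)
open import Data.Product.Base using (Σ; ∃; ∃₂; _×_)
open import Data.Sum.Base using (_⊎_)
open import Data.Vec.Functional using (Vector; fromList)
open import Relation.Binary.Core using (Rel)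
open import Relation.Binary.Structures using (IsDecTotalOrder)
open import Relation.Nullary using (¬_)
open import Relation.Nullary.Decidable using (¬?)
open import Relation.Unary using (Pred; _∈_; _⊆_; _≐_; _∪_; Satisfiable)

-- The standard library has no real numbers.  Scalars are taken from an
-- arbitrary ordered field; classically, ℝ is one.

record OrderedField (c ℓ₁ ℓ₂ : Level) : Set (suc (c ⊔ ℓ₁ ⊔ ℓ₂)) where
  infix  4 _≤_
  infix  8 _⁻¹
  field
    commutativeRing : CommutativeRing c ℓ₁
  open CommutativeRing commutativeRing public
  field
    _≤_             : Rel Carrier ℓ₂
    isDecTotalOrder : IsDecTotalOrder _≈_ _≤_
    +-monoʳ-≤       : ∀ x {y z} → y ≤ z → x + y ≤ x + z
    *-nonNeg        : ∀ {x y} → 0# ≤ x → 0# ≤ y → 0# ≤ x * y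
    0≉1             : 0# ≉ 1#
    -- The value of 0# ⁻¹ is unconstrained.
    _⁻¹             : Carrier → Carrier
    ⁻¹-inverseʳ     : ∀ {x} → x ≉ 0# → x * x ⁻¹ ≈ 1#

  open Mult +-monoid using () renaming (_×_ to _×ℕ_)

  fromℤ : ℤ → Carrier
  fromℤ (+ n)    = n ×ℕ 1#
  fromℤ -[1+ n ] = - ((1+ n) ×ℕ 1#)

record EuclideanSpace {c ℓ₁ ℓ₂} (K : OrderedField c ℓ₁ ℓ₂) (e ℓ : Level)
                      : Set (c ⊔ ℓ₁ ⊔ ℓ₂ ⊔ suc (e ⊔ ℓ)) where
  private module K = OrderedField K
  open K using (Carrier; _≈_; _≤_; _+_; _*_; 0#)
  field
    vectorSpace : Module K.commutativeRing e ℓ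
  open Module vectorSpace public
  field
    ⟪_,_⟫      : Carrierᴹ → Carrierᴹ → Carrier
    ⟪⟫-cong    : ∀ {x x′ y y′} → x ≈ᴹ x′ → y ≈ᴹ y′ → ⟪ x , y ⟫ ≈ ⟪ x′ , y′ ⟫
    ⟪⟫-sym     : ∀ x y → ⟪ x , y ⟫ ≈ ⟪ y , x ⟫
    ⟪⟫-+       : ∀ x y z → ⟪ x +ᴹ y , z ⟫ ≈ ⟪ x , z ⟫ + ⟪ y , z ⟫
    ⟪⟫-*       : ∀ a x y → ⟪ a *ₗ x , y ⟫ ≈ a * ⟪ x , y ⟫
    ⟪⟫-nonNeg  : ∀ x → 0# ≤ ⟪ x , x ⟫
    ⟪⟫-definite : ∀ {x} → ⟪ x , x ⟫ ≈ 0# → x ≈ᴹ 0ᴹ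

module RootSystems {c ℓ₁ ℓ₂ e ℓ} {K : OrderedField c ℓ₁ ℓ₂}
                   (E : EuclideanSpace K e ℓ) where

  open OrderedField K
    using (_≈_; _≉_; _≤_; _+_; _*_; -_; _⁻¹; 0#; 1#; fromℤ)
    renaming (Carrier to Scalar)
  open EuclideanSpace E
  open Sum +ᴹ-commutativeMonoid using (sum)
  open Membership ≈ᴹ-setoid using () renaming (_∈_ to _∈ᴸ_)

  lincomb : ∀ {n} → Vector Scalar n → Vector Carrierᴹ n → Carrierᴹ
  lincomb a v = sum (λ i → a i *ₗ v i)

  LinearlyIndependent : ∀ {n} → Vector Carrierᴹ n → Set (c ⊔ ℓ₁ ⊔ ℓ)
  LinearlyIndependent v = ∀ a → lincomb a v ≈ᴹ 0ᴹ → ∀ i → a i ≈ 0#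

  module _ {p} (P : Pred Carrierᴹ p) where

    Span : Pred Carrierᴹ (c ⊔ e ⊔ ℓ ⊔ p)
    Span x = Σ ℕ λ n → Σ (Vector Scalar n) λ a → Σ (Vector Carrierᴹ n) λ v →
      (∀ i → v i ∈ P) × x ≈ᴹ lincomb a v

    Cone : Pred Carrierᴹ (c ⊔ ℓ₂ ⊔ e ⊔ ℓ ⊔ p)
    Cone x = Σ ℕ λ n → Σ (Vector Scalar n) λ a → Σ (Vector Carrierᴹ n) λ v →
      (∀ i → 0# ≤ a i) × (∀ i → v i ∈ P) × x ≈ᴹ lincomb a v

    Finite : Set (e ⊔ ℓ ⊔ p)
    Finite = ∃ λ (xs : List Carrierᴹ) → P ≐ (_∈ᴸ xs)

    Spanning : Set (c ⊔ e ⊔ ℓ ⊔ p)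
    Spanning = ∀ x → x ∈ Span

    Neg : Pred Carrierᴹ p
    Neg x = -ᴹ x ∈ P

  -- 2 ⟪ x , α ⟫ / ⟪ α , α ⟫
  cartan : Carrierᴹ → Carrierᴹ → Scalar
  cartan x α = (1# + 1#) * ⟪ x , α ⟫ * ⟪ α , α ⟫ ⁻¹

  reflect : Carrierᴹ → Carrierᴹ → Carrierᴹ
  reflect α x = x +ᴹ -ᴹ (cartan x α *ₗ α)

  -- Reduced crystallographic root system in the linear span of Φ, which need
  -- not be the whole space.  The reflections are orthogonal, so the inner
  -- product is invariant under the Weyl group.
  record IsRootSystem {p} (Φ : Pred Carrierᴹ p) : Set (c ⊔ ℓ₁ ⊔ e ⊔ ℓ ⊔ p) where
    field
      finite          : Finite Φ
      nonzero         : ∀ {α} → α ∈ Φ → α ≉ᴹ 0ᴹ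
      reduced         : ∀ {α} a → α ∈ Φ → a *ₗ α ∈ Φ → a ≈ 1# ⊎ a ≈ - 1#
      reflect-closed  : ∀ {α β} → α ∈ Φ → β ∈ Φ → reflect α β ∈ Φ
      crystallographic : ∀ {α β} → α ∈ Φ → β ∈ Φ → ∃ λ k → cartan β α ≈ fromℤ k

  IsRootSubsystem : ∀ {p q} → Pred Carrierᴹ p → Pred Carrierᴹ q →
                    Set (c ⊔ ℓ₁ ⊔ e ⊔ ℓ ⊔ p ⊔ q)
  IsRootSubsystem Ψ Φ = Ψ ⊆ Φ × IsRootSystem Ψ

  Irreducible : ∀ {p} → Pred Carrierᴹ p → Set (ℓ₁ ⊔ e ⊔ suc p)
  Irreducible {p} Φ = Satisfiable Φ × ¬ ∃₂ λ (P Q : Pred Carrierᴹ p) →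
    Satisfiable P × Satisfiable Q × Φ ≐ (P ∪ Q) ×
    (∀ {x y} → x ∈ P → y ∈ Q → ⟪ x , y ⟫ ≈ 0#)

  -- A simple system is given as a family Δ; by linear independence it is
  -- injective, so it amounts to a subset of Φ, and the coordinates of a root
  -- are unique.
  record IsSimpleSystem {p n} (Φ : Pred Carrierᴹ p) (Δ : Vector Carrierᴹ n)
                        : Set (c ⊔ ℓ₁ ⊔ ℓ₂ ⊔ e ⊔ ℓ ⊔ p) where
    field
      root        : ∀ i → Δ i ∈ Φ
      independent : LinearlyIndependent Δ
      coord       : ∀ {γ} → γ ∈ Φ → Vector Scalar n
      expansion   : ∀ {γ} (γ∈Φ : γ ∈ Φ) → γ ≈ᴹ lincomb (coord γ∈Φ) Δ
      same-sign   : ∀ {γ} (γ∈Φ : γ ∈ Φ) →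
                    (∀ i → 0# ≤ coord γ∈Φ i) ⊎ (∀ i → coord γ∈Φ i ≤ 0#)

    Positive : Pred Carrierᴹ (ℓ₂ ⊔ p)
    Positive γ = Σ (γ ∈ Φ) λ γ∈Φ → ∀ i → 0# ≤ coord γ∈Φ i

    Supp : ∀ {γ} → γ ∈ Φ → Pred (Fin n) ℓ₁
    Supp γ∈Φ i = coord γ∈Φ i ≉ 0#

    -- Φ_{S,β}
    Slice : Subset n → ∀ {β} → β ∈ Φ → Pred Carrierᴹ (ℓ₁ ⊔ p)
    Slice S β∈Φ γ = Σ (γ ∈ Φ) λ γ∈Φ →
      ∀ i → i ∈ˢ S → coord γ∈Φ i ≈ coord β∈Φ i

    -- Φ_{S,ℤβ}
    ℤSlice : Subset n → ∀ {β} → β ∈ Φ → Pred Carrierᴹ (ℓ₁ ⊔ p)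
    ℤSlice S β∈Φ γ = Σ (γ ∈ Φ) λ γ∈Φ → ∃ λ (k : ℤ) →
      ∀ i → i ∈ˢ S → coord γ∈Φ i ≈ fromℤ k * coord β∈Φ i

    infix 4 _≼_
    _≼_ : Rel Carrierᴹ (c ⊔ ℓ₂ ⊔ e ⊔ ℓ ⊔ p)
    α ≼ β = (β +ᴹ -ᴹ α) ∈ Cone Positive

    IsMin IsMax : ∀ {q} → Pred Carrierᴹ q → Pred Carrierᴹ (c ⊔ ℓ₂ ⊔ e ⊔ ℓ ⊔ p ⊔ q)
    IsMin P m = m ∈ P × (∀ {γ} → γ ∈ P → m ≼ γ)
    IsMax P M = M ∈ P × (∀ {γ} → γ ∈ P → γ ≼ M)

    IsInterval : ∀ {q} → Pred Carrierᴹ q → Set (c ⊔ ℓ₂ ⊔ e ⊔ ℓ ⊔ p ⊔ q)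
    IsInterval P = P ⊆ Positive × ∃₂ λ m M → IsMin P m × IsMax P M ×
      (∀ {γ} → γ ∈ Positive → m ≼ γ → γ ≼ M → γ ∈ P)

  outside : ∀ {n} → Subset n → List (Fin n)
  outside {n} S = filter (λ i → ¬? (i ∈ˢ? S)) (allFin n)

  -- The subfamily Π ∖ S of Π.
  infixl 7 _∖_
  _∖_ : ∀ {n} (Π : Vector Carrierᴹ n) (S : Subset n) →
        Vector Carrierᴹ (length (map Π (outside S)))
  Π ∖ S = fromList (map Π (outside S))

{-# OPTIONS --safe #-}

-- Let Λ be Π ∖ S or -(Π ∖ S), and let m have minimal Λ-height in Φ[S,β].  Call
-- x antidominant if ⟪ x , α ⟫ ≤ 0 for all α in Λ.  If γ and m are antidominant
-- of S-levels k ≥ 1 and 1, then ⟪ γ , m ⟫ > 0: their components along span Λ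
-- have nonpositive coordinates, hence pair nonnegatively, while the orthogonal
-- components are positive multiples of that of β, which is nonzero.  So γ - m
-- is zero or a root.  Descending by elements of Λ, and by m once γ is
-- antidominant, every root of level k ≥ 1 is k m plus a nonnegative combination
-- of Λ.  This gives the minimum for Λ = Π ∖ S, the maximum for Λ = -(Π ∖ S),
-- and both simple systems.  Reflecting any element of Φ[S,β] down to an
-- antidominant one γ gives ‖γ‖ ≤ ‖m‖ since γ - m is nonnegative on Λ, so both
-- extremes have the maximal length in Φ[S,β].
module Submission where

open import Defs
open import Algebra.Bundles using (CommutativeMonoid; RawRing)
import Algebra.Module.Properties.LeftModule as LeftModuleProperties
import Algebra.Properties.AbelianGroup as AbelianGroupProperties
import Algebra.Properties.CommutativeMonoid.Sum as Sum
import Algebra.Properties.Ring as RingProperties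
import Algebra.Properties.Semiring.Mult as SemiringMult
import Algebra.Properties.Semiring.Sum as SemiringSum
import Algebra.Solver.Ring as RingSolver
open import Algebra.Solver.Ring.AlmostCommutativeRing
  using (fromCommutativeRing; _-Raw-AlmostCommutative⟶_)
open import Data.Fin.Base using (Fin; zero; suc)
import Data.Fin.Properties as Fin
open import Data.Fin.Subset using (Subset; ⁅_⁆) renaming (_∈_ to _∈ˢ_; _∉_ to _∉ˢ_)
open import Data.Fin.Subset.Properties using (x∈⁅x⁆; x∈⁅y⁆⇒x≡y) renaming (_∈?_ to _∈ˢ?_)
open import Data.Integer.Base as ℤ using (ℤ; +_; -[1+_])
open import Data.Integer.Divisibility.Signed using (divides; _∣?_)
import Data.Integer.Properties as ℤ
open import Data.List.Base as List using (List; filter; length)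
open import Data.List.Membership.Propositional using () renaming (_∈_ to _∈ᴾ_)
open import Data.List.Membership.Propositional.Properties using (∈-filter⁺; ∈-allFin)
import Data.List.Membership.Setoid as Membership
open import Data.List.Membership.Setoid.Properties using (∈-resp-≈)
open import Data.List.Relation.Unary.All as All using (All)
open import Data.List.Relation.Unary.All.Properties using (all-filter)
import Data.List.Relation.Unary.AllPairs as AllPairs
open import Data.List.Relation.Unary.Any using (Any; here; there; any?)
open import Data.List.Relation.Unary.Unique.Propositional using (Unique)
open import Data.List.Relation.Unary.Unique.Propositional.Properties using (allFin⁺; filter⁺)
open import Data.Maybe.Base using (Maybe; just; nothing)
open import Data.Nat.Base as ℕ using (ℕ; zero; suc)
import Data.Nat.Induction as ℕ
import Data.Nat.Properties as ℕ
open import Data.Product.Base using (∃; _×_; _,_; proj₁; proj₂)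
open import Data.Sum.Base using (_⊎_; inj₁; inj₂)
open import Data.Vec.Functional using (Vector; _∷_; fromList)
open import Function.Base using (_∘_)
open import Induction.WellFounded using (WellFounded; Acc; acc; module Subrelation)
open import Level using (Level; _⊔_)
import Relation.Binary.Construct.On as On
open import Relation.Binary.PropositionalEquality.Core as ≡ using (_≡_; _≢_)
import Relation.Binary.Reasoning.Setoid as SetoidReasoning
open import Relation.Binary.Structures using (IsDecTotalOrder)
open import Relation.Nullary using (¬_; Dec; yes; no; contradiction)
open import Relation.Nullary.Decidable using (¬?; _→-dec_; _×-dec_)
open import Relation.Unary using (Pred; _∈_; _⊆_; _≐_; Decidable)

-- A root of least Λ-height in Φ[S,β] need not a priori have least Λ-coordinates. The gap closes
-- because a root of level 0 lies in the span of Λ and has Λ-coordinates of one sign: applied to γ -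
-- m, minimality of the height of m decides which sign. Π ∖ S and its negative share one argument,
-- since negating Λ negates the Λ-coordinates and turns least into greatest. That argument produces
-- the simple system consisting of the maximum M and -(Π ∖ S); the negative of this family is the
-- one asked for. In (3) the simple system structure is an arbitrary one, so its coordinates need
-- not be those constructed for (2). The S-coordinates with respect to Π vanish on Π ∖ S, and they
-- tie the γ-coordinate of any such structure to the level.

-- Ordered fields: the image of the integers, the ring solver, sign rules.

module OrderedFieldProperties {c ℓ₁ ℓ₂} (K : OrderedField c ℓ₁ ℓ₂) where

  open OrderedField K hiding (zero)
  open SemiringMult semiring using (×-homo-+; ×1-homo-*) renaming (_×_ to _×ℕ_)
  open RingProperties ring
    using (-0#≈0#; -‿involutive; -‿distribˡ-*; -‿distribʳ-*; -‿+-comm)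
  open SetoidReasoning setoid

  abstract
    fromℤ-⊖ : ∀ m n → fromℤ (m ℤ.⊖ n) ≈ m ×ℕ 1# + - (n ×ℕ 1#)
    fromℤ-⊖ m zero = begin
      m ×ℕ 1#        ≈⟨ +-identityʳ _ ⟨
      m ×ℕ 1# + 0#   ≈⟨ +-congˡ -0#≈0# ⟨
      m ×ℕ 1# + - 0# ∎
    fromℤ-⊖ zero (suc n) = sym (+-identityˡ _)
    fromℤ-⊖ (suc m) (suc n) = begin
      fromℤ (suc m ℤ.⊖ suc n)                 ≡⟨ ≡.cong fromℤ (ℤ.[1+m]⊖[1+n]≡m⊖n m n) ⟩
      fromℤ (m ℤ.⊖ n)                         ≈⟨ fromℤ-⊖ m n ⟩
      M + - N                                 ≈⟨ +-identityˡ _ ⟨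
      0# + (M + - N)                          ≈⟨ +-congʳ (-‿inverseʳ 1#) ⟨
      1# + - 1# + (M + - N)                   ≈⟨ +-assoc _ _ _ ⟩
      1# + (- 1# + (M + - N))                 ≈⟨ +-congˡ (+-assoc _ _ _) ⟨
      1# + (- 1# + M + - N)                   ≈⟨ +-congˡ (+-congʳ (+-comm _ _)) ⟩
      1# + (M + - 1# + - N)                   ≈⟨ +-congˡ (+-assoc _ _ _) ⟩
      1# + (M + (- 1# + - N))                 ≈⟨ +-assoc _ _ _ ⟨
      1# + M + (- 1# + - N)                   ≈⟨ +-congˡ (-‿+-comm _ _) ⟩
      1# + M + - (1# + N)                     ∎
      where
      M N : Carrier
      M = m ×ℕ 1#
      N = n ×ℕ 1#

    fromℤ-neg : ∀ i → fromℤ (ℤ.- i) ≈ - fromℤ i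
    fromℤ-neg (+ zero)   = sym -0#≈0#
    fromℤ-neg (+ suc n)  = refl
    fromℤ-neg -[1+ n ]   = sym (-‿involutive _)

    fromℤ-+ : ∀ i j → fromℤ (i ℤ.+ j) ≈ fromℤ i + fromℤ j
    fromℤ-+ (+ m)    (+ n)    = ×-homo-+ 1# m n
    fromℤ-+ (+ m)    -[1+ n ] = fromℤ-⊖ m (suc n)
    fromℤ-+ -[1+ m ] (+ n)    = trans (fromℤ-⊖ n (suc m)) (+-comm _ _)
    fromℤ-+ -[1+ m ] -[1+ n ] = begin
      fromℤ (-[1+ m ] ℤ.+ -[1+ n ])                  ≡⟨ ≡.cong fromℤ (ℤ.neg-distrib-+ (+ suc m) (+ suc n)) ⟨
      fromℤ (ℤ.- (+ suc m ℤ.+ + suc n))              ≈⟨ -‿cong (×-homo-+ 1# (suc m) (suc n)) ⟩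
      - (suc m ×ℕ 1# + suc n ×ℕ 1#)                    ≈⟨ -‿+-comm _ _ ⟨
      - (suc m ×ℕ 1#) + - (suc n ×ℕ 1#)                ∎

    fromℤ-pos-* : ∀ m j → fromℤ (+ m ℤ.* j) ≈ fromℤ (+ m) * fromℤ j
    fromℤ-pos-* m (+ n) = begin
      fromℤ (+ m ℤ.* + n)  ≡⟨ ≡.cong fromℤ (ℤ.pos-* m n) ⟨
      (m ℕ.* n) ×ℕ 1#       ≈⟨ ×1-homo-* m n ⟩
      m ×ℕ 1# * n ×ℕ 1#      ∎
    fromℤ-pos-* m -[1+ n ] = begin
      fromℤ (+ m ℤ.* -[1+ n ])         ≡⟨ ≡.cong fromℤ (ℤ.neg-distribʳ-* (+ m) (+ suc n)) ⟨
      fromℤ (ℤ.- (+ m ℤ.* + suc n))    ≈⟨ fromℤ-neg (+ m ℤ.* + suc n) ⟩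
      - fromℤ (+ m ℤ.* + suc n)        ≈⟨ -‿cong (fromℤ-pos-* m (+ suc n)) ⟩
      - (m ×ℕ 1# * suc n ×ℕ 1#)          ≈⟨ -‿distribʳ-* _ _ ⟩
      m ×ℕ 1# * - (suc n ×ℕ 1#)          ∎

    fromℤ-* : ∀ i j → fromℤ (i ℤ.* j) ≈ fromℤ i * fromℤ j
    fromℤ-* (+ m)    j = fromℤ-pos-* m j
    fromℤ-* -[1+ m ] j = begin
      fromℤ (-[1+ m ] ℤ.* j)        ≡⟨ ≡.cong fromℤ (ℤ.neg-distribˡ-* (+ suc m) j) ⟨
      fromℤ (ℤ.- (+ suc m ℤ.* j))   ≈⟨ fromℤ-neg (+ suc m ℤ.* j) ⟩
      - fromℤ (+ suc m ℤ.* j)       ≈⟨ -‿cong (fromℤ-pos-* (suc m) j) ⟩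
      - (suc m ×ℕ 1# * fromℤ j)      ≈⟨ -‿distribˡ-* _ _ ⟩
      - (suc m ×ℕ 1#) * fromℤ j      ∎

  private
    ℤ-rawRing : RawRing _ _
    ℤ-rawRing = record
      { Carrier = ℤ ; _≈_ = _≡_ ; _+_ = ℤ._+_ ; _*_ = ℤ._*_ ; -_ = ℤ.-_ ; 0# = + 0 ; 1# = + 1 }

    fromℤ-morphism : ℤ-rawRing -Raw-AlmostCommutative⟶ fromCommutativeRing commutativeRing
    fromℤ-morphism = record
      { ⟦_⟧    = fromℤ
      ; +-homo = fromℤ-+
      ; *-homo = fromℤ-*
      ; -‿homo = fromℤ-neg
      ; 0-homo = refl
      -- `fromℤ (+ 1)` is `1# + 0#`, so `con (+ 1)` does not denote `1#` itself; solver calls that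
      -- involve `1#` therefore pass it as a variable.
      ; 1-homo = +-identityʳ 1#
      }

    coefficient≟ : ∀ i j → Maybe (fromℤ i ≈ fromℤ j)
    coefficient≟ i j with i ℤ.≟ j
    ... | yes ≡.refl = just refl
    ... | no _       = nothing

  open RingSolver ℤ-rawRing (fromCommutativeRing commutativeRing) fromℤ-morphism
    coefficient≟ public
    using (solve; _:=_; _:+_; _:*_; :-_; _:-_; con)

  open IsDecTotalOrder isDecTotalOrder public
    using (total; antisym; ≤-respˡ-≈; ≤-respʳ-≈; _≤?_)
    renaming (refl to ≤-refl; reflexive to ≤-reflexive; trans to ≤-trans; _≟_ to _≈?_)

  infix 4 _<_
  -- A negation, so that a strict inequality refutes its opposite directly; totality and
  -- decidability of `_≤_` supply `<⇒≤` and `≮⇒≥`.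
  _<_ : Carrier → Carrier → Set ℓ₂
  x < y = ¬ (y ≤ x)

  <⇒≤ : ∀ {x y} → x < y → x ≤ y
  <⇒≤ {x} {y} y≰x with total x y
  ... | inj₁ x≤y = x≤y
  ... | inj₂ y≤x = contradiction y≤x y≰x

  <⇒≉ : ∀ {x y} → x < y → y ≉ x
  <⇒≉ x<y y≈x = x<y (≤-reflexive y≈x)

  ≤∧≉⇒< : ∀ {x y} → x ≤ y → y ≉ x → x < y
  ≤∧≉⇒< x≤y y≉x y≤x = y≉x (antisym y≤x x≤y)

  <-≤-trans : ∀ {x y z} → x < y → y ≤ z → x < z
  <-≤-trans x<y y≤z z≤x = x<y (≤-trans y≤z z≤x)

  ≤-<-trans : ∀ {x y z} → x ≤ y → y < z → x < z
  ≤-<-trans x≤y y<z z≤x = y<z (≤-trans z≤x x≤y)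

  ≮⇒≥ : ∀ {x y} → ¬ (x < y) → y ≤ x
  ≮⇒≥ {x} {y} x≮y with y ≤? x
  ... | yes y≤x = y≤x
  ... | no  y≰x = contradiction y≰x x≮y

  _<?_ : ∀ x y → Dec (x < y)
  x <? y = ¬? (y ≤? x)

  abstract
    0≤y-x⇒x≤y : ∀ {x y} → 0# ≤ y + - x → x ≤ y
    0≤y-x⇒x≤y {x} {y} h = ≤-respˡ-≈ (+-identityʳ x) (≤-respʳ-≈
      (solve 2 (λ x y → x :+ (y :- x) := y) refl x y) (+-monoʳ-≤ x h))

    x≤y⇒0≤y-x : ∀ {x y} → x ≤ y → 0# ≤ y + - x
    x≤y⇒0≤y-x {x} {y} h = ≤-respˡ-≈ (-‿inverseˡ x) (≤-respʳ-≈ (+-comm _ _) (+-monoʳ-≤ (- x) h))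

    +-nonNeg : ∀ {x y} → 0# ≤ x → 0# ≤ y → 0# ≤ x + y
    +-nonNeg {x} 0≤x 0≤y = ≤-trans 0≤x (≤-respˡ-≈ (+-identityʳ x) (+-monoʳ-≤ x 0≤y))

    +-mono-≤ : ∀ {x y u v} → x ≤ y → u ≤ v → x + u ≤ y + v
    +-mono-≤ {x} {y} {u} {v} x≤y u≤v = 0≤y-x⇒x≤y (≤-respʳ-≈
      (solve 4 (λ x y u v → (y :- x) :+ (v :- u) := (y :+ v) :- (x :+ u)) refl x y u v)
      (+-nonNeg (x≤y⇒0≤y-x x≤y) (x≤y⇒0≤y-x u≤v)))

    neg-nonNeg : ∀ {x} → x ≤ 0# → 0# ≤ - x
    neg-nonNeg x≤0 = ≤-respʳ-≈ (+-identityˡ _) (x≤y⇒0≤y-x x≤0)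

    neg-nonPos : ∀ {x} → 0# ≤ x → - x ≤ 0#
    neg-nonPos {x} 0≤x = 0≤y-x⇒x≤y (≤-respʳ-≈ (solve 1 (λ x → x := con (+ 0) :- (:- x)) refl x) 0≤x)

    *-nonPos : ∀ {x y} → 0# ≤ x → y ≤ 0# → x * y ≤ 0#
    *-nonPos {x} {y} 0≤x y≤0 = 0≤y-x⇒x≤y (≤-respʳ-≈
      (solve 2 (λ x y → x :* (:- y) := con (+ 0) :- (x :* y)) refl x y)
      (*-nonNeg 0≤x (neg-nonNeg y≤0)))

    nonPos-*-nonPos : ∀ {x y} → x ≤ 0# → y ≤ 0# → 0# ≤ x * y
    nonPos-*-nonPos {x} {y} x≤0 y≤0 = ≤-respʳ-≈
      (solve 2 (λ x y → (:- x) :* (:- y) := x :* y) refl x y)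
      (*-nonNeg (neg-nonNeg x≤0) (neg-nonNeg y≤0))

    x-y≈0⇒x≈y : ∀ {x y} → x + - y ≈ 0# → x ≈ y
    x-y≈0⇒x≈y {x} {y} h = begin
      x               ≈⟨ solve 2 (λ x y → x := (x :- y) :+ y) refl x y ⟩
      x + - y + y     ≈⟨ +-congʳ h ⟩
      0# + y          ≈⟨ +-identityˡ y ⟩
      y               ∎

    x*y≈0⇒y≈0 : ∀ {x y} → x ≉ 0# → x * y ≈ 0# → y ≈ 0#
    x*y≈0⇒y≈0 {x} {y} x≉0 xy≈0 = begin
      y                ≈⟨ *-identityˡ y ⟨
      1# * y           ≈⟨ *-congʳ (⁻¹-inverseʳ x≉0) ⟨
      x * x ⁻¹ * y     ≈⟨ solve 3 (λ x y i → x :* i :* y := i :* (x :* y)) refl x y (x ⁻¹) ⟩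
      x ⁻¹ * (x * y)   ≈⟨ *-congˡ xy≈0 ⟩
      x ⁻¹ * 0#        ≈⟨ zeroʳ _ ⟩
      0#               ∎

    *-cancelˡ : ∀ {x y z} → x ≉ 0# → x * y ≈ x * z → y ≈ z
    *-cancelˡ {x} {y} {z} x≉0 xy≈xz = x-y≈0⇒x≈y (x*y≈0⇒y≈0 x≉0 (begin
      x * (y + - z)        ≈⟨ solve 3 (λ x y z → x :* (y :- z) := x :* y :- x :* z) refl x y z ⟩
      x * y + - (x * z)    ≈⟨ +-congʳ xy≈xz ⟩
      x * z + - (x * z)    ≈⟨ -‿inverseʳ _ ⟩
      0#                   ∎))

    *-pos : ∀ {x y} → 0# < x → 0# < y → 0# < x * y
    *-pos 0<x 0<y = ≤∧≉⇒< (*-nonNeg (<⇒≤ 0<x) (<⇒≤ 0<y))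
      (λ xy≈0 → <⇒≉ 0<y (x*y≈0⇒y≈0 (<⇒≉ 0<x) xy≈0))

    +-pos : ∀ {x y} → 0# < x → 0# ≤ y → 0# < x + y
    +-pos {x} 0<x 0≤y = <-≤-trans 0<x (≤-respˡ-≈ (+-identityʳ x) (+-monoʳ-≤ x 0≤y))

    0<1 : 0# < 1#
    0<1 1≤0 = 0≉1 (antisym
      (≤-respʳ-≈ (*-identityˡ 1#) (nonPos-*-nonPos 1≤0 1≤0)) 1≤0)

    x*y≥0⇒y≥0 : ∀ {x y} → 0# < x → 0# ≤ x * y → 0# ≤ y
    x*y≥0⇒y≥0 {x} {y} 0<x 0≤xy with total 0# y
    ... | inj₁ 0≤y = 0≤y
    ... | inj₂ y≤0 = ≤-reflexive (sym (x*y≈0⇒y≈0 (<⇒≉ 0<x) (antisym (*-nonPos (<⇒≤ 0<x) y≤0) 0≤xy)))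

    ⁻¹-pos : ∀ {x} → 0# < x → 0# < x ⁻¹
    ⁻¹-pos {x} 0<x x⁻¹≤0 = 0<1 (≤-respˡ-≈ (⁻¹-inverseʳ (<⇒≉ 0<x)) (*-nonPos (<⇒≤ 0<x) x⁻¹≤0))

    x<x+1 : ∀ x → x < x + 1#
    x<x+1 x x+1≤x = 0<1 (0≤y-x⇒x≤y (≤-respʳ-≈
      (solve 2 (λ x o → x :- (x :+ o) := con (+ 0) :- o) refl x 1#) (x≤y⇒0≤y-x x+1≤x)))

    fromℕ-nonNeg : ∀ n → 0# ≤ fromℤ (+ n)
    fromℕ-nonNeg zero    = ≤-refl
    fromℕ-nonNeg (suc n) = +-nonNeg (<⇒≤ 0<1) (fromℕ-nonNeg n)

    fromℕ-pos : ∀ n → 0# < fromℤ (+ suc n)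
    fromℕ-pos n = +-pos 0<1 (fromℕ-nonNeg n)

    fromℤ≈0⇒≡0 : ∀ {i} → fromℤ i ≈ 0# → i ≡ + 0
    fromℤ≈0⇒≡0 {+ zero}   _ = ≡.refl
    fromℤ≈0⇒≡0 {+ suc n}  h = contradiction h (<⇒≉ (fromℕ-pos n))
    fromℤ≈0⇒≡0 { -[1+ n ]} h = contradiction
      (trans (sym (-‿involutive _)) (trans (-‿cong h) -0#≈0#)) (<⇒≉ (fromℕ-pos n))

    fromℤ-injective : ∀ {i j} → fromℤ i ≈ fromℤ j → i ≡ j
    fromℤ-injective {i} {j} h = ℤ.i-j≡0⇒i≡j i j (fromℤ≈0⇒≡0 (begin
      fromℤ (i ℤ.- j)          ≈⟨ fromℤ-+ i (ℤ.- j) ⟩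
      fromℤ i + fromℤ (ℤ.- j)  ≈⟨ +-cong h (fromℤ-neg j) ⟩
      fromℤ j + - fromℤ j      ≈⟨ -‿inverseʳ _ ⟩
      0#                       ∎))

    0<fromℤ⇒suc : ∀ i → 0# < fromℤ i → ∃ λ n → i ≡ + suc n
    0<fromℤ⇒suc (+ zero)  h = contradiction ≤-refl h
    0<fromℤ⇒suc (+ suc n) h = n , ≡.refl
    0<fromℤ⇒suc -[1+ n ]  h = contradiction (neg-nonPos (fromℕ-nonNeg (suc n))) h

    -- Meant for a Cartan integer `n + 2` of γ against δ, with x the squared length of δ and y the
    -- product of γ and δ: twice the excess `y - x` is `n * x`.
    2+n*x≈y+y⇒x≤y : ∀ n {x y} → 0# ≤ x → fromℤ (+ suc (suc n)) * x ≈ y + y → x ≤ y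
    2+n*x≈y+y⇒x≤y n {x} {y} 0≤x h = 0≤y-x⇒x≤y (x*y≥0⇒y≥0 {1# + 1#} (+-pos 0<1 (<⇒≤ 0<1))
      (≤-respʳ-≈ eq (*-nonNeg (fromℕ-nonNeg n) 0≤x)))
      where
      eq : fromℤ (+ n) * x ≈ (1# + 1#) * (y + - x)
      eq = begin
        fromℤ (+ n) * x
          ≈⟨ solve 3 (λ o n x → n :* x := (o :+ (o :+ n)) :* x :- (o :* x :+ o :* x)) refl 1# (fromℤ (+ n)) x ⟩
        fromℤ (+ suc (suc n)) * x + - (1# * x + 1# * x)
          ≈⟨ +-cong h (-‿cong (+-cong (*-identityˡ x) (*-identityˡ x))) ⟩
        y + y + - (x + x)
          ≈⟨ solve 2 (λ y x → y :+ y :- (x :+ x) := (y :- x) :+ (y :- x)) refl y x ⟩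
        (y + - x) + (y + - x)
          ≈⟨ +-cong (*-identityˡ _) (*-identityˡ _) ⟨
        1# * (y + - x) + 1# * (y + - x)
          ≈⟨ distribʳ _ _ _ ⟨
        (1# + 1#) * (y + - x) ∎

-- Linear algebra: finite sums, linear functionals, projections, obtuse families.

module SingletonSum {a ℓ} (M : CommutativeMonoid a ℓ) where

  open CommutativeMonoid M
  open Sum M using (sum; sum-cong-≋; sum-replicate-zero)

  sum-zero : ∀ {n} (f : Vector Carrier n) → (∀ i → f i ≈ ε) → sum f ≈ ε
  sum-zero {n} f h = trans (sum-cong-≋ h) (sum-replicate-zero n)

  sum-single : ∀ {n} (f : Vector Carrier n) j → (∀ i → i ≢ j → f i ≈ ε) → sum f ≈ f j
  sum-single f zero    h = trans (∙-congˡ (sum-zero (f ∘ suc) (λ i → h (suc i) λ ()))) (identityʳ _)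
  sum-single f (suc j) h = trans (∙-cong (h zero λ ()) (sum-single (f ∘ suc) j
    (λ i i≢j → h (suc i) (i≢j ∘ Fin.suc-injective)))) (identityˡ _)

module EuclideanProperties {c ℓ₁ ℓ₂ e ℓ} {K : OrderedField c ℓ₁ ℓ₂} (E : EuclideanSpace K e ℓ) where

  open OrderedField K hiding (zero) renaming (Carrier to Scalar)
  open OrderedFieldProperties K
  open EuclideanSpace E
  open RootSystems E using (lincomb; LinearlyIndependent)
  open SemiringSum semiring using (sum; sum-cong-≋; sum-replicate-zero; ∑-distrib-+; *-distribˡ-sum)
  open SingletonSum +-commutativeMonoid using (sum-zero; sum-single) public
  private module Sumᴹ = Sum +ᴹ-commutativeMonoid
  open SetoidReasoning setoid

  sum-nonNeg : ∀ {n} (f : Vector Scalar n) → (∀ i → 0# ≤ f i) → 0# ≤ sum f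
  sum-nonNeg {zero}  f h = ≤-refl
  sum-nonNeg {suc n} f h = +-nonNeg (h zero) (sum-nonNeg (f ∘ suc) (h ∘ suc))

  sum-nonPos : ∀ {n} (f : Vector Scalar n) → (∀ i → f i ≤ 0#) → sum f ≤ 0#
  sum-nonPos {zero}  f h = ≤-refl
  sum-nonPos {suc n} f h = ≤-respʳ-≈ (+-identityˡ 0#) (+-mono-≤ (h zero) (sum-nonPos (f ∘ suc) (h ∘ suc)))

  sum-neg : ∀ {n} (f : Vector Scalar n) → sum (λ i → - f i) ≈ - sum f
  sum-neg f = trans (sum-cong-≋ (λ i → neg (f i))) (trans (sym (*-distribˡ-sum (- 1#) f)) (sym (neg (sum f))))
    where
    neg : ∀ x → - x ≈ - 1# * x
    neg x = trans (-‿cong (sym (*-identityˡ x))) (solve 2 (λ o x → :- (o :* x) := (:- o) :* x) refl 1# x)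

  -- All terms in fact vanish. This is what converts a bound on a height, a sum of coordinates, into
  -- bounds on the single coordinates.
  sum-nonPos-≥0 : ∀ {n} (f : Vector Scalar n) → (∀ i → f i ≤ 0#) → 0# ≤ sum f → ∀ i → 0# ≤ f i
  sum-nonPos-≥0 {suc n} f h 0≤s zero = ≤-trans 0≤s
    (≤-respʳ-≈ (+-identityʳ _) (+-mono-≤ ≤-refl (sum-nonPos (f ∘ suc) (h ∘ suc))))
  sum-nonPos-≥0 {suc n} f h 0≤s (suc i) = sum-nonPos-≥0 (f ∘ suc) (h ∘ suc)
    (≤-trans 0≤s (≤-respʳ-≈ (+-identityˡ _) (+-mono-≤ (h zero) ≤-refl))) i

  infixl 6 _-ᴹ_
  _-ᴹ_ : Carrierᴹ → Carrierᴹ → Carrierᴹ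
  x -ᴹ y = x +ᴹ -ᴹ y

  record IsLinear (f : Carrierᴹ → Scalar) : Set (c ⊔ ℓ₁ ⊔ e ⊔ ℓ) where
    field
      cong   : ∀ {x y} → x ≈ᴹ y → f x ≈ f y
      homo-+ : ∀ x y → f (x +ᴹ y) ≈ f x + f y
      homo-* : ∀ a x → f (a *ₗ x) ≈ a * f x

    homo-0 : f 0ᴹ ≈ 0#
    homo-0 = trans (cong (≈ᴹ-sym (*ₗ-zeroˡ 0ᴹ))) (trans (homo-* 0# 0ᴹ) (zeroˡ _))

    homo-neg : ∀ x → f (-ᴹ x) ≈ - f x
    homo-neg x = begin
      f (-ᴹ x)                    ≈⟨ solve 2 (λ x y → y := (x :+ y) :- x) refl (f x) (f (-ᴹ x)) ⟩
      f x + f (-ᴹ x) + - f x      ≈⟨ +-congʳ (homo-+ x (-ᴹ x)) ⟨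
      f (x +ᴹ -ᴹ x) + - f x       ≈⟨ +-congʳ (trans (cong (-ᴹ‿inverseʳ x)) homo-0) ⟩
      0# + - f x                  ≈⟨ +-identityˡ _ ⟩
      - f x                       ∎

    homo-- : ∀ x y → f (x -ᴹ y) ≈ f x + - f y
    homo-- x y = trans (homo-+ x (-ᴹ y)) (+-congˡ (homo-neg y))

    homo-lincomb : ∀ {n} (a : Vector Scalar n) v → f (lincomb a v) ≈ sum (λ i → a i * f (v i))
    homo-lincomb {zero}  a v = homo-0
    homo-lincomb {suc n} a v = trans (homo-+ _ _)
      (+-cong (homo-* _ _) (homo-lincomb (a ∘ suc) (v ∘ suc)))

  negated : ∀ {f} → IsLinear f → IsLinear (λ x → - f x)
  negated {f} lin = record
    { cong   = -‿cong ∘ F.cong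
    ; homo-+ = λ x y → trans (-‿cong (F.homo-+ x y)) (solve 2 (λ x y → :- (x :+ y) := :- x :- y) refl (f x) (f y))
    ; homo-* = λ a x → trans (-‿cong (F.homo-* a x)) (solve 2 (λ a x → :- (a :* x) := a :* (:- x)) refl a (f x))
    }
    where module F = IsLinear lin

  sum-linear : ∀ {n} (f : Fin n → Carrierᴹ → Scalar) → (∀ i → IsLinear (f i)) → IsLinear (λ x → sum (λ i → f i x))
  sum-linear f lin = record
    { cong   = λ x≈y → sum-cong-≋ (λ i → IsLinear.cong (lin i) x≈y)
    ; homo-+ = λ x y → trans (sum-cong-≋ (λ i → IsLinear.homo-+ (lin i) x y))
        (∑-distrib-+ (λ i → f i x) (λ i → f i y))
    ; homo-* = λ a x → trans (sum-cong-≋ (λ i → IsLinear.homo-* (lin i) a x))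
        (sym (*-distribˡ-sum a (λ i → f i x)))
    }

  ⟪⟫-linearˡ : ∀ y → IsLinear (λ x → ⟪ x , y ⟫)
  ⟪⟫-linearˡ y = record
    { cong   = λ x≈x′ → ⟪⟫-cong x≈x′ ≈ᴹ-refl
    ; homo-+ = λ x x′ → ⟪⟫-+ x x′ y
    ; homo-* = λ a x → ⟪⟫-* a x y
    }

  ⟪⟫-linearʳ : ∀ x → IsLinear (λ y → ⟪ x , y ⟫)
  ⟪⟫-linearʳ x = record
    { cong   = λ y≈y′ → ⟪⟫-cong ≈ᴹ-refl y≈y′
    ; homo-+ = λ y y′ → trans (⟪⟫-sym x _) (trans (⟪⟫-+ y y′ x) (+-cong (⟪⟫-sym y x) (⟪⟫-sym y′ x)))
    ; homo-* = λ a y → trans (⟪⟫-sym x _) (trans (⟪⟫-* a y x) (*-congˡ (⟪⟫-sym y x)))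
    }

  module Pairingˡ y = IsLinear (⟪⟫-linearˡ y)
  module Pairingʳ x = IsLinear (⟪⟫-linearʳ x)

  abstract
    norm-- : ∀ x y → ⟪ x -ᴹ y , x -ᴹ y ⟫ ≈ ⟪ x , x ⟫ + - ⟪ x , y ⟫ + (⟪ y , y ⟫ + - ⟪ x , y ⟫)
    norm-- x y = begin
      ⟪ x -ᴹ y , x -ᴹ y ⟫
        ≈⟨ Pairingˡ.homo-- _ x y ⟩
      ⟪ x , x -ᴹ y ⟫ + - ⟪ y , x -ᴹ y ⟫
        ≈⟨ +-cong (Pairingʳ.homo-- x x y) (-‿cong (Pairingʳ.homo-- y x y)) ⟩
      ⟪ x , x ⟫ + - ⟪ x , y ⟫ + - (⟪ y , x ⟫ + - ⟪ y , y ⟫)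
        ≈⟨ +-congˡ (-‿cong (+-congʳ (⟪⟫-sym y x))) ⟩
      ⟪ x , x ⟫ + - ⟪ x , y ⟫ + - (⟪ x , y ⟫ + - ⟪ y , y ⟫)
        ≈⟨ solve 3 (λ a b d → a :- b :+ :- (b :- d) := a :- b :+ (d :- b)) refl _ _ _ ⟩
      ⟪ x , x ⟫ + - ⟪ x , y ⟫ + (⟪ y , y ⟫ + - ⟪ x , y ⟫) ∎

    x-y≈0⇒x≈ᴹy : ∀ {x y} → x -ᴹ y ≈ᴹ 0ᴹ → x ≈ᴹ y
    x-y≈0⇒x≈ᴹy {x} {y} h = R.begin
      x               R.≈⟨ +ᴹ-identityʳ x ⟨
      x +ᴹ 0ᴹ         R.≈⟨ +ᴹ-congˡ (-ᴹ‿inverseˡ y) ⟨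
      x +ᴹ (-ᴹ y +ᴹ y) R.≈⟨ +ᴹ-assoc _ _ _ ⟨
      x -ᴹ y +ᴹ y     R.≈⟨ +ᴹ-congʳ h ⟩
      0ᴹ +ᴹ y         R.≈⟨ +ᴹ-identityˡ y ⟩
      y               R.∎
      where module R = SetoidReasoning ≈ᴹ-setoid

    norm-pos : ∀ {x} → x ≉ᴹ 0ᴹ → 0# < ⟪ x , x ⟫
    norm-pos {x} x≉0 = ≤∧≉⇒< (⟪⟫-nonNeg x) (x≉0 ∘ ⟪⟫-definite)

  lincomb-cong : ∀ {n} {a b : Vector Scalar n} {v w} → (∀ i → a i ≈ b i) → (∀ i → v i ≈ᴹ w i) →
                 lincomb a v ≈ᴹ lincomb b w
  lincomb-cong a≈b v≈w = Sumᴹ.sum-cong-≋ (λ i → *ₗ-cong (a≈b i) (v≈w i))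

  lincomb-+ : ∀ {n} (a b : Vector Scalar n) v → lincomb (λ i → a i + b i) v ≈ᴹ lincomb a v +ᴹ lincomb b v
  lincomb-+ a b v = ≈ᴹ-trans (Sumᴹ.sum-cong-≋ (λ i → *ₗ-distribʳ (v i) (a i) (b i)))
    (Sumᴹ.∑-distrib-+ (λ i → a i *ₗ v i) (λ i → b i *ₗ v i))

  lincomb-* : ∀ {n} s (a : Vector Scalar n) v → lincomb (λ i → s * a i) v ≈ᴹ s *ₗ lincomb a v
  lincomb-* {zero}  s a v = ≈ᴹ-sym (*ₗ-zeroʳ s)
  lincomb-* {suc n} s a v = ≈ᴹ-trans
    (+ᴹ-cong (*ₗ-assoc s (a zero) (v zero)) (lincomb-* s (a ∘ suc) (v ∘ suc)))
    (≈ᴹ-sym (*ₗ-distribˡ s _ _))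

  abstract
    -- Gram–Schmidt, without assuming v independent.
    projection : ∀ {n} (v : Vector Carrierᴹ n) x →
                 ∃ λ a → ∀ j → ⟪ lincomb a v , v j ⟫ ≈ ⟪ x , v j ⟫
    projection {zero}  v x = (λ ()) , λ ()
    projection {suc n} v x = t ∷ b , λ where
        zero    → trans (⟪b,y⟫ (v zero)) t-spec
        (suc j) → trans (⟪b,y⟫ (v (suc j))) (begin
          t * ⟪ v zero , v (suc j) ⟫ + (⟪ p , v (suc j) ⟫ + - (t * ⟪ q , v (suc j) ⟫))
            ≈⟨ +-congˡ (+-cong (a-spec j) (-‿cong (*-congˡ (a₀-spec j)))) ⟩
          t * ⟪ v zero , v (suc j) ⟫ + (⟪ x , v (suc j) ⟫ + - (t * ⟪ v zero , v (suc j) ⟫))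
            ≈⟨ solve 2 (λ u y → u :+ (y :- u) := y) refl _ _ ⟩
          ⟪ x , v (suc j) ⟫ ∎)
      where
      v′ : Vector Carrierᴹ n
      v′ = v ∘ suc
      a a₀ : Vector Scalar n
      a = proj₁ (projection v′ x)
      a-spec : ∀ j → ⟪ lincomb a v′ , v′ j ⟫ ≈ ⟪ x , v′ j ⟫
      a-spec = proj₂ (projection v′ x)
      a₀ = proj₁ (projection v′ (v zero))
      a₀-spec : ∀ j → ⟪ lincomb a₀ v′ , v′ j ⟫ ≈ ⟪ v zero , v′ j ⟫
      a₀-spec = proj₂ (projection v′ (v zero))
      p q w : Carrierᴹ
      p = lincomb a v′
      q = lincomb a₀ v′
      w = v zero -ᴹ q
      -- The combination sought is `p` plus `t` times `w`. As `w` is orthogonal to `v′`, its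
      -- pairings with `v′` are right for every `t`; the pairing with `v zero` is right when
      -- `D * t ≈ R`.
      D R : Scalar
      D = ⟪ v zero , v zero ⟫ + - ⟪ q , v zero ⟫
      R = ⟪ x , v zero ⟫ + - ⟪ p , v zero ⟫

      ⟪z,q⟫ : ∀ z → (∀ j → ⟪ z , v′ j ⟫ ≈ 0#) → ⟪ z , q ⟫ ≈ 0#
      ⟪z,q⟫ z z⊥ = trans (Pairingʳ.homo-lincomb z a₀ v′)
        (sum-zero _ λ j → trans (*-congˡ (z⊥ j)) (zeroʳ _))

      ⟪-⟫ : ∀ {z z′} → (∀ j → ⟪ z′ , v′ j ⟫ ≈ ⟪ z , v′ j ⟫) → ∀ j → ⟪ z -ᴹ z′ , v′ j ⟫ ≈ 0#
      ⟪-⟫ h j = trans (Pairingˡ.homo-- _ _ _) (trans (+-congˡ (-‿cong (h j))) (-‿inverseʳ _))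

      D≈⟪w,w⟫ : D ≈ ⟪ w , w ⟫
      D≈⟪w,w⟫ = begin
        D                                ≈⟨ Pairingˡ.homo-- _ _ _ ⟨
        ⟪ w , v zero ⟫                   ≈⟨ solve 1 (λ y → y := y :- con (+ 0)) refl _ ⟩
        ⟪ w , v zero ⟫ + - 0#            ≈⟨ +-congˡ (-‿cong (⟪z,q⟫ w (⟪-⟫ a₀-spec))) ⟨
        ⟪ w , v zero ⟫ + - ⟪ w , q ⟫     ≈⟨ Pairingʳ.homo-- _ _ _ ⟨
        ⟪ w , w ⟫                        ∎

      R≈⟪x-p,w⟫ : R ≈ ⟪ x -ᴹ p , w ⟫
      R≈⟪x-p,w⟫ = begin
        R                                          ≈⟨ Pairingˡ.homo-- _ _ _ ⟨
        ⟪ x -ᴹ p , v zero ⟫                        ≈⟨ solve 1 (λ y → y := y :- con (+ 0)) refl _ ⟩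
        ⟪ x -ᴹ p , v zero ⟫ + - 0#                 ≈⟨ +-congˡ (-‿cong (⟪z,q⟫ _ (⟪-⟫ a-spec))) ⟨
        ⟪ x -ᴹ p , v zero ⟫ + - ⟪ x -ᴹ p , q ⟫     ≈⟨ Pairingʳ.homo-- _ _ _ ⟨
        ⟪ x -ᴹ p , w ⟫                             ∎

      solution : ∃ λ t → D * t ≈ R
      solution with D ≈? 0#
      ... | no  D≉0 = D ⁻¹ * R , trans (sym (*-assoc _ _ _)) (trans (*-congʳ (⁻¹-inverseʳ D≉0)) (*-identityˡ R))
      -- Here `w` is zero, so `v zero` already lies in the span of `v′` and `R` vanishes too: any
      -- `t` would do.
      ... | yes D≈0 = 0# , trans (zeroʳ D) (sym (trans R≈⟪x-p,w⟫
        (trans (Pairingʳ.cong _ (⟪⟫-definite (trans (sym D≈⟪w,w⟫) D≈0))) (Pairingʳ.homo-0 _))))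

      t : Scalar
      t = proj₁ solution
      b : Vector Scalar n
      b i = a i + - t * a₀ i

      ⟪b,y⟫ : ∀ y → ⟪ lincomb (t ∷ b) v , y ⟫ ≈ t * ⟪ v zero , y ⟫ + (⟪ p , y ⟫ + - (t * ⟪ q , y ⟫))
      ⟪b,y⟫ y = trans (⟪⟫-+ _ _ y) (+-cong (⟪⟫-* _ _ y) (begin
        ⟪ lincomb b v′ , y ⟫
          ≈⟨ Pairingˡ.cong y (lincomb-+ a (λ i → - t * a₀ i) v′) ⟩
        ⟪ p +ᴹ lincomb (λ i → - t * a₀ i) v′ , y ⟫
          ≈⟨ ⟪⟫-+ _ _ y ⟩
        ⟪ p , y ⟫ + ⟪ lincomb (λ i → - t * a₀ i) v′ , y ⟫
          ≈⟨ +-congˡ (trans (Pairingˡ.cong y (lincomb-* (- t) a₀ v′)) (⟪⟫-* _ _ y)) ⟩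
        ⟪ p , y ⟫ + - t * ⟪ q , y ⟫
          ≈⟨ +-congˡ (solve 2 (λ t z → (:- t) :* z := :- (t :* z)) refl _ _) ⟩
        ⟪ p , y ⟫ + - (t * ⟪ q , y ⟫) ∎))

      t-spec : t * ⟪ v zero , v zero ⟫ + (⟪ p , v zero ⟫ + - (t * ⟪ q , v zero ⟫)) ≈ ⟪ x , v zero ⟫
      t-spec = begin
        t * ⟪ v zero , v zero ⟫ + (⟪ p , v zero ⟫ + - (t * ⟪ q , v zero ⟫))
          ≈⟨ solve 4 (λ t u y z → t :* u :+ (y :- t :* z) := (u :- z) :* t :+ y) refl _ _ _ _ ⟩
        D * t + ⟪ p , v zero ⟫
          ≈⟨ +-congʳ (proj₂ solution) ⟩
        R + ⟪ p , v zero ⟫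
          ≈⟨ solve 2 (λ y z → (y :- z) :+ z := y) refl _ _ ⟩
        ⟪ x , v zero ⟫ ∎

  positivePart : ∀ x → ∃ λ x⁺ → 0# ≤ x⁺ × (x⁺ ≈ 0# × x ≤ 0# ⊎ x⁺ ≈ x)
  positivePart x with total x 0#
  ... | inj₁ x≤0 = 0# , ≤-refl , inj₁ (refl , x≤0)
  ... | inj₂ 0≤x = x , 0≤x , inj₂ refl

  abstract
    -- The positive part p of the combination satisfies ⟪ p , p ⟫ ≤ 0.
    antidominant⇒nonPos : ∀ {n} (v : Vector Carrierᴹ n) → LinearlyIndependent v →
      (∀ i j → i ≢ j → ⟪ v i , v j ⟫ ≤ 0#) →
      ∀ a → (∀ j → ⟪ lincomb a v , v j ⟫ ≤ 0#) → ∀ j → a j ≤ 0#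
    antidominant⇒nonPos {n} v independent obtuse a h j with proj₂ (proj₂ (positivePart (a j)))
    ... | inj₁ (_ , aj≤0) = aj≤0
    ... | inj₂ a⁺≈a       = ≤-reflexive (trans (sym a⁺≈a) (independent a⁺ p≈0 j))
      where
      a⁺ : Vector Scalar n
      a⁺ i = proj₁ (positivePart (a i))

      p : Carrierᴹ
      p = lincomb a⁺ v

      -- These are the terms of ⟪ p , p ⟫. When `a⁺ k` is `a k`, passing from the given combination
      -- to `p` adds nonnegative multiples of the `v i` with `i ≢ k` only; by obtuseness this cannot
      -- raise the pairing with `v k`, which was nonpositive.
      term : ∀ k → a⁺ k * ⟪ p , v k ⟫ ≤ 0#
      term k with positivePart (a k) in eq
      ... | _ , _ , inj₁ (≈0 , _) = ≤-reflexive (trans (*-congʳ ≈0) (zeroˡ _))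
      ... | s , 0≤s , inj₂ s≈ak = *-nonPos 0≤s (0≤y-x⇒x≤y
          (≤-respʳ-≈ (solve 2 (λ y z → :- y :+ :- (z :- y) := con (+ 0) :- z) refl _ _)
          (+-nonNeg (neg-nonNeg (h k)) (neg-nonNeg p-a≤0))))
        where
        summand : ∀ i → (a⁺ i + - a i) * ⟪ v i , v k ⟫ ≤ 0#
        summand i with i Fin.≟ k
        ... | yes ≡.refl = ≤-reflexive (trans (*-congʳ (trans (+-congʳ
                (trans (reflexive (≡.cong proj₁ eq)) s≈ak)) (-‿inverseʳ _))) (zeroˡ _))
        ... | no i≢k = *-nonPos 0≤a⁺-a (obtuse i k i≢k)
          where
          0≤a⁺-a : 0# ≤ a⁺ i + - a i
          0≤a⁺-a with positivePart (a i)
          ... | _ , 0≤s′ , inj₁ (_ , ai≤0) = +-nonNeg 0≤s′ (neg-nonNeg ai≤0)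
          ... | _ , _ , inj₂ s′≈ai = ≤-reflexive (sym (trans (+-congʳ s′≈ai) (-‿inverseʳ _)))

        p-a≤0 : ⟪ p , v k ⟫ + - ⟪ lincomb a v , v k ⟫ ≤ 0#
        p-a≤0 = ≤-respˡ-≈ (begin
          sum (λ i → (a⁺ i + - a i) * ⟪ v i , v k ⟫)
            ≈⟨ sum-cong-≋ (λ i → solve 3 (λ x y z → (x :- y) :* z := x :* z :+ :- (y :* z)) refl (a⁺ i) (a i) _) ⟩
          sum (λ i → a⁺ i * ⟪ v i , v k ⟫ + - (a i * ⟪ v i , v k ⟫))
            ≈⟨ ∑-distrib-+ (λ i → a⁺ i * ⟪ v i , v k ⟫) (λ i → - (a i * ⟪ v i , v k ⟫)) ⟩
          sum (λ i → a⁺ i * ⟪ v i , v k ⟫) + sum (λ i → - (a i * ⟪ v i , v k ⟫))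
            ≈⟨ +-cong (sym (Pairingˡ.homo-lincomb _ a⁺ v)) (trans (sum-neg (λ i → a i * ⟪ v i , v k ⟫))
                 (-‿cong (sym (Pairingˡ.homo-lincomb _ a v)))) ⟩
          ⟪ p , v k ⟫ + - ⟪ lincomb a v , v k ⟫ ∎)
          (sum-nonPos _ summand)

      p≈0 : p ≈ᴹ 0ᴹ
      p≈0 = ⟪⟫-definite (antisym
        (≤-respˡ-≈ (sym (Pairingʳ.homo-lincomb p a⁺ v)) (sum-nonPos _ term))
        (⟪⟫-nonNeg p))

-- Root systems: descent along a linear functional, lengths, differences of roots.

module RootSystemProperties {c ℓ₁ ℓ₂ e ℓ p} {K : OrderedField c ℓ₁ ℓ₂} (E : EuclideanSpace K e ℓ)
  (Φ : Pred (EuclideanSpace.Carrierᴹ E) p)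
  (isRootSystem : RootSystems.IsRootSystem E Φ) where

  open OrderedField K hiding (zero) renaming (Carrier to Scalar)
  open OrderedFieldProperties K
  open EuclideanSpace E
  open EuclideanProperties E
  open RootSystems E
  open IsRootSystem isRootSystem
  open Membership ≈ᴹ-setoid using (find) renaming (_∈_ to _∈ᴸ_)
  open SetoidReasoning setoid

  private
    roots : List Carrierᴹ
    roots = proj₁ finite

    listed : ∀ {γ} → γ ∈ Φ → γ ∈ᴸ roots
    listed = proj₁ (proj₂ finite)

    unlisted : ∀ {γ} → γ ∈ᴸ roots → γ ∈ Φ
    unlisted = proj₂ (proj₂ finite)

  -- A predicate on vectors need not respect `≈ᴹ`, but Φ does: finiteness equates it with setoid
  -- membership in a list.
  ∈-resp : ∀ {x y} → x ≈ᴹ y → x ∈ Φ → y ∈ Φ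
  ∈-resp x≈y = unlisted ∘ ∈-resp-≈ ≈ᴹ-setoid x≈y ∘ listed

  -- `Q` has to be decided on roots only. For Φ_{S,ℤβ} this matters, because its decision procedure
  -- starts from the integrality of the coefficients of a root.
  finite-filter : ∀ {q} {Q : Pred Carrierᴹ q} → (∀ {x y} → x ≈ᴹ y → Q x → Q y) →
                  (∀ {x} → x ∈ Φ → Dec (Q x)) → Finite (λ x → x ∈ Φ × Q x)
  finite-filter {Q = Q} resp Q? with sift roots unlisted
    where
    sift : ∀ xs → (∀ {x} → x ∈ᴸ xs → x ∈ Φ) →
           ∃ λ ys → (∀ {x} → x ∈ᴸ xs → Q x → x ∈ᴸ ys) × (∀ {x} → x ∈ᴸ ys → x ∈ᴸ xs × Q x)
    sift List.[] _ = List.[] , (λ ()) , λ ()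
    sift (z List.∷ xs) ⊆Φ with sift xs (⊆Φ ∘ there) | Q? (⊆Φ (here ≈ᴹ-refl))
    ... | ys , to , from | yes Qz = z List.∷ ys
      , (λ { (here x≈z) _ → here x≈z ; (there x∈) Qx → there (to x∈ Qx) })
      , (λ { (here x≈z) → here x≈z , resp (≈ᴹ-sym x≈z) Qz
           ; (there x∈) → there (proj₁ (from x∈)) , proj₂ (from x∈) })
    ... | ys , to , from | no ¬Qz = ys
      , (λ { (here x≈z) Qx → contradiction (resp x≈z Qx) ¬Qz ; (there x∈) Qx → to x∈ Qx })
      , (λ x∈ → there (proj₁ (from x∈)) , proj₂ (from x∈))
  ... | ys , to , from = ys , (λ (x∈Φ , Qx) → to (listed x∈Φ) Qx)
                            , (λ x∈ → unlisted (proj₁ (from x∈)) , proj₂ (from x∈))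

  module Descent {h : Carrierᴹ → Scalar} (h-linear : IsLinear h) where

    private module H = IsLinear h-linear

    infix 4 _≺_
    _≺_ : Carrierᴹ → Carrierᴹ → Set (p ⊔ ℓ₂)
    δ ≺ γ = δ ∈ Φ × h δ < h γ

    private
      -- The order of the field need not be well-founded, so descent is measured by the number of
      -- listed roots on which `h` is smaller. If δ is listed and `h δ < h γ`, this number drops
      -- strictly from γ to δ, as δ is counted for γ but not for itself.
      rank : List Carrierᴹ → Carrierᴹ → ℕ
      rank xs γ = length (filter (λ x → h x <? h γ) xs)

      rank-mono-≤ : ∀ xs {δ γ} → h δ ≤ h γ → rank xs δ ℕ.≤ rank xs γ
      rank-mono-≤ List.[] _ = ℕ.z≤n
      rank-mono-≤ (x List.∷ xs) {δ} {γ} δ≤γ with h δ ≤? h x | h γ ≤? h x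
      ... | no _    | no _    = ℕ.s≤s (rank-mono-≤ xs δ≤γ)
      ... | no x<δ  | yes γ≤x = contradiction (≤-trans δ≤γ γ≤x) x<δ
      ... | yes _   | no _    = ℕ.m≤n⇒m≤1+n (rank-mono-≤ xs δ≤γ)
      ... | yes _   | yes _   = rank-mono-≤ xs δ≤γ

      rank-mono-< : ∀ xs {δ γ} → δ ∈ᴸ xs → h δ < h γ → rank xs δ ℕ.< rank xs γ
      rank-mono-< (x List.∷ xs) {δ} {γ} δ∈ δ<γ with h δ ≤? h x | h γ ≤? h x
      rank-mono-< (x List.∷ xs) (here δ≈x) δ<γ | no x<δ | _ = contradiction (≤-reflexive (H.cong δ≈x)) x<δ
      rank-mono-< (x List.∷ xs) (here δ≈x) δ<γ | _ | yes γ≤x =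
        contradiction (≤-trans γ≤x (≤-reflexive (sym (H.cong δ≈x)))) δ<γ
      rank-mono-< (x List.∷ xs) (here δ≈x) δ<γ | yes _ | no _ = ℕ.s≤s (rank-mono-≤ xs (<⇒≤ δ<γ))
      rank-mono-< (x List.∷ xs) (there δ∈) δ<γ | no _ | no _ = ℕ.s≤s (rank-mono-< xs δ∈ δ<γ)
      rank-mono-< (x List.∷ xs) (there δ∈) δ<γ | no x<δ | yes γ≤x = contradiction (≤-trans (<⇒≤ δ<γ) γ≤x) x<δ
      rank-mono-< (x List.∷ xs) (there δ∈) δ<γ | yes _ | no _ = ℕ.m≤n⇒m≤1+n (rank-mono-< xs δ∈ δ<γ)
      rank-mono-< (x List.∷ xs) (there δ∈) δ<γ | yes _ | yes _ = rank-mono-< xs δ∈ δ<γ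

    abstract
      ≺-wellFounded : WellFounded _≺_
      ≺-wellFounded = Subrelation.wellFounded
        (λ (δ∈Φ , δ<γ) → rank-mono-< roots (listed δ∈Φ) δ<γ)
        (On.wellFounded (rank roots) ℕ.<-wellFounded)

      minimum : ∀ {q} {Q : Pred Carrierᴹ q} → (∀ {x y} → x ≈ᴹ y → Q x → Q y) → Decidable Q →
                ∀ {γ} → γ ∈ Φ → Q γ → ∃ λ m → m ∈ Φ × Q m × (∀ {δ} → δ ∈ Φ → Q δ → h m ≤ h δ)
      minimum {Q = Q} resp Q? {γ} = go γ (≺-wellFounded γ)
        where
        go : ∀ γ → Acc _≺_ γ → γ ∈ Φ → Q γ → ∃ λ m → m ∈ Φ × Q m × (∀ {δ} → δ ∈ Φ → Q δ → h m ≤ h δ)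
        go γ (acc rec) γ∈Φ Qγ with any? (λ x → Q? x ×-dec (h x <? h γ)) roots
        ... | yes lower = let x , x∈ , Qx , x<γ = find lower in go x (rec (unlisted x∈ , x<γ)) (unlisted x∈) Qx
        ... | no ¬lower = γ , γ∈Φ , Qγ , λ δ∈Φ Qδ → ≮⇒≥ (λ δ<γ → ¬lower (below (listed δ∈Φ) Qδ δ<γ))
          where
          below : ∀ {δ xs} → δ ∈ᴸ xs → Q δ → h δ < h γ → Any (λ x → Q x × h x < h γ) xs
          below (here δ≈x) Qδ δ<γ = here (resp δ≈x Qδ , ≤-<-trans (≤-reflexive (sym (H.cong δ≈x))) δ<γ)
          below (there δ∈) Qδ δ<γ = there (below δ∈ Qδ δ<γ)

  abstract
    norm-root : ∀ {α} → α ∈ Φ → 0# < ⟪ α , α ⟫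
    norm-root = norm-pos ∘ nonzero

    cartan-*-norm : ∀ x {α} → α ∈ Φ → cartan x α * ⟪ α , α ⟫ ≈ ⟪ x , α ⟫ + ⟪ x , α ⟫
    cartan-*-norm x {α} α∈Φ = begin
      (1# + 1#) * ⟪ x , α ⟫ * ⟪ α , α ⟫ ⁻¹ * ⟪ α , α ⟫
        ≈⟨ solve 4 (λ o x i a → (o :+ o) :* x :* i :* a := (o :* x :+ o :* x) :* (a :* i)) refl
               1# ⟪ x , α ⟫ (⟪ α , α ⟫ ⁻¹) ⟪ α , α ⟫ ⟩
      (1# * ⟪ x , α ⟫ + 1# * ⟪ x , α ⟫) * (⟪ α , α ⟫ * ⟪ α , α ⟫ ⁻¹)
        ≈⟨ *-cong (+-cong (*-identityˡ _) (*-identityˡ _)) (⁻¹-inverseʳ (<⇒≉ (norm-root α∈Φ))) ⟩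
      (⟪ x , α ⟫ + ⟪ x , α ⟫) * 1#
        ≈⟨ *-identityʳ _ ⟩
      ⟪ x , α ⟫ + ⟪ x , α ⟫ ∎

    cartan-pos : ∀ {x α} → α ∈ Φ → 0# < ⟪ x , α ⟫ → 0# < cartan x α
    cartan-pos α∈Φ 0<xα = *-pos (*-pos (+-pos 0<1 (<⇒≤ 0<1)) 0<xα) (⁻¹-pos (norm-root α∈Φ))

    reflect-isometry : ∀ {α} → α ∈ Φ → ∀ x → ⟪ reflect α x , reflect α x ⟫ ≈ ⟪ x , x ⟫
    reflect-isometry {α} α∈Φ x = begin
      ⟪ reflect α x , reflect α x ⟫
        ≈⟨ norm-- x (k *ₗ α) ⟩
      ⟪ x , x ⟫ + - ⟪ x , k *ₗ α ⟫ + (⟪ k *ₗ α , k *ₗ α ⟫ + - ⟪ x , k *ₗ α ⟫)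
        ≈⟨ +-cong (+-congˡ (-‿cong x·kα)) (+-cong kα·kα (-‿cong x·kα)) ⟩
      ⟪ x , x ⟫ + - (k * ⟪ x , α ⟫) + (k * (⟪ x , α ⟫ + ⟪ x , α ⟫) + - (k * ⟪ x , α ⟫))
        ≈⟨ solve 3 (λ n k y → n :- k :* y :+ (k :* (y :+ y) :- k :* y) := n) refl ⟪ x , x ⟫ k ⟪ x , α ⟫ ⟩
      ⟪ x , x ⟫ ∎
      where
      k : Scalar
      k = cartan x α
      x·kα : ⟪ x , k *ₗ α ⟫ ≈ k * ⟪ x , α ⟫
      x·kα = Pairingʳ.homo-* x k α
      kα·kα : ⟪ k *ₗ α , k *ₗ α ⟫ ≈ k * (⟪ x , α ⟫ + ⟪ x , α ⟫)
      kα·kα = trans (⟪⟫-* k α _) (*-congˡ (trans (Pairingʳ.homo-* α k α) (cartan-*-norm x α∈Φ)))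

    neg-∈ : ∀ {α} → α ∈ Φ → -ᴹ α ∈ Φ
    neg-∈ {α} α∈Φ = ∈-resp (R.begin
      α -ᴹ cartan α α *ₗ α        R.≈⟨ +ᴹ-congˡ (-ᴹ‿cong (*ₗ-congʳ cartan≈2)) ⟩
      α -ᴹ (1# + 1#) *ₗ α         R.≈⟨ +ᴹ-congˡ (-ᴹ‿cong (≈ᴹ-trans (*ₗ-distribʳ α 1# 1#)
                                        (+ᴹ-cong (*ₗ-identityˡ α) (*ₗ-identityˡ α)))) ⟩
      α -ᴹ (α +ᴹ α)               R.≈⟨ +ᴹ-congˡ (⁻¹-∙-comm α α) ⟨
      α +ᴹ (-ᴹ α -ᴹ α)            R.≈⟨ +ᴹ-assoc _ _ _ ⟨
      α -ᴹ α -ᴹ α                 R.≈⟨ +ᴹ-congʳ (-ᴹ‿inverseʳ α) ⟩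
      0ᴹ -ᴹ α                     R.≈⟨ +ᴹ-identityˡ _ ⟩
      -ᴹ α                        R.∎) (reflect-closed α∈Φ α∈Φ)
      where
      module R = SetoidReasoning ≈ᴹ-setoid
      open AbelianGroupProperties +ᴹ-abelianGroup using (⁻¹-∙-comm)
      cartan≈2 : cartan α α ≈ 1# + 1#
      cartan≈2 = trans (*-assoc _ _ _) (trans (*-congˡ (⁻¹-inverseʳ (<⇒≉ (norm-root α∈Φ)))) (*-identityʳ _))

    difference-or-≤ : ∀ {γ δ} → γ ∈ Φ → δ ∈ Φ → 0# < ⟪ γ , δ ⟫ → γ -ᴹ δ ∈ Φ ⊎ ⟪ δ , δ ⟫ ≤ ⟪ γ , δ ⟫
    difference-or-≤ {γ} {δ} γ∈Φ δ∈Φ 0<γδ with crystallographic δ∈Φ γ∈Φ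
    ... | k , ≈k with 0<fromℤ⇒suc k (<-≤-trans (cartan-pos δ∈Φ 0<γδ) (≤-reflexive ≈k))
    ... | zero , ≡.refl = inj₁ (∈-resp
          (+ᴹ-congˡ (-ᴹ‿cong (≈ᴹ-trans (*ₗ-congʳ (trans ≈k (+-identityʳ 1#))) (*ₗ-identityˡ δ))))
          (reflect-closed δ∈Φ γ∈Φ))
    ... | suc n , ≡.refl = inj₂ (2+n*x≈y+y⇒x≤y n (⟪⟫-nonNeg δ)
          (trans (*-congʳ (sym ≈k)) (cartan-*-norm γ δ∈Φ)))

    -- Either some Cartan integer is 1, and a reflection gives the difference, or
    -- both are at least 2, which forces ‖γ - δ‖² ≤ 0.
    difference : ∀ {γ δ} → γ ∈ Φ → δ ∈ Φ → 0# < ⟪ γ , δ ⟫ → γ ≈ᴹ δ ⊎ γ -ᴹ δ ∈ Φ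
    difference {γ} {δ} γ∈Φ δ∈Φ 0<γδ
      with difference-or-≤ γ∈Φ δ∈Φ 0<γδ
         | difference-or-≤ δ∈Φ γ∈Φ (<-≤-trans 0<γδ (≤-reflexive (⟪⟫-sym γ δ)))
    ... | inj₁ γ-δ∈Φ | _ = inj₂ γ-δ∈Φ
    ... | inj₂ _ | inj₁ δ-γ∈Φ = inj₂ (∈-resp (⁻¹-anti-homo‿- δ γ) (neg-∈ δ-γ∈Φ))
      where open AbelianGroupProperties +ᴹ-abelianGroup using (⁻¹-anti-homo‿-)
    ... | inj₂ δδ≤γδ | inj₂ γγ≤δγ = inj₁ (x-y≈0⇒x≈ᴹy (⟪⟫-definite (antisym
          (≤-respˡ-≈ (sym (norm-- γ δ)) (≤-respʳ-≈ (+-identityˡ 0#) (+-mono-≤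
            (x-y≤0 (≤-respʳ-≈ (⟪⟫-sym δ γ) γγ≤δγ)) (x-y≤0 δδ≤γδ))))
          (⟪⟫-nonNeg _))))
      where
      x-y≤0 : ∀ {x y} → x ≤ y → x + - y ≤ 0#
      x-y≤0 {x} {y} x≤y = 0≤y-x⇒x≤y (≤-respʳ-≈
        (solve 2 (λ x y → y :- x := con (+ 0) :- (x :- y)) refl x y) (x≤y⇒0≤y-x x≤y))

-- Coordinates with respect to Π and their integrality on roots.

module Coordinates {c ℓ₁ ℓ₂ e ℓ p} {K : OrderedField c ℓ₁ ℓ₂} (E : EuclideanSpace K e ℓ)
  (Φ : Pred (EuclideanSpace.Carrierᴹ E) p)
  (isRootSystem : RootSystems.IsRootSystem E Φ) (spanning : RootSystems.Spanning E Φ)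
  {n : ℕ} (Π : Vector (EuclideanSpace.Carrierᴹ E) n) (Π-simple : RootSystems.IsSimpleSystem E Φ Π)
  where

  open OrderedField K hiding (zero) renaming (Carrier to Scalar)
  open OrderedFieldProperties K
  open EuclideanSpace E
  open EuclideanProperties E
  open RootSystems E
  open IsRootSystem isRootSystem
  open RootSystemProperties E Φ isRootSystem
  open SemiringSum semiring using (sum)
  private
    module Simple = IsSimpleSystem Π-simple
    module Sumᴹ = Sum +ᴹ-commutativeMonoid
  open SetoidReasoning setoid

  abstract
    lincomb-injective : ∀ {a b : Vector Scalar n} → lincomb a Π ≈ᴹ lincomb b Π → ∀ i → a i ≈ b i
    lincomb-injective {a} {b} h i = x-y≈0⇒x≈y (trans (+-congˡ neg)
      (Simple.independent (λ i → a i + - 1# * b i) (R.begin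
      lincomb (λ i → a i + - 1# * b i) Π            R.≈⟨ lincomb-+ a (λ i → - 1# * b i) Π ⟩
      lincomb a Π +ᴹ lincomb (λ i → - 1# * b i) Π   R.≈⟨ +ᴹ-cong h (lincomb-* (- 1#) b Π) ⟩
      lincomb b Π +ᴹ - 1# *ₗ lincomb b Π            R.≈⟨ +ᴹ-congʳ (*ₗ-identityˡ _) ⟨
      1# *ₗ lincomb b Π +ᴹ - 1# *ₗ lincomb b Π      R.≈⟨ *ₗ-distribʳ _ 1# (- 1#) ⟨
      (1# + - 1#) *ₗ lincomb b Π                    R.≈⟨ *ₗ-congʳ (-‿inverseʳ 1#) ⟩
      0# *ₗ lincomb b Π                             R.≈⟨ *ₗ-zeroˡ _ ⟩
      0ᴹ                                            R.∎) i))
      where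
      module R = SetoidReasoning ≈ᴹ-setoid
      neg : - b i ≈ - 1# * b i
      neg = trans (-‿cong (sym (*-identityˡ _))) (solve 2 (λ o x → :- (o :* x) := (:- o) :* x) refl 1# (b i))

    lincomb-lincomb : ∀ {k} (a : Vector Scalar k) (b : Fin k → Vector Scalar n) →
      lincomb a (λ j → lincomb (b j) Π) ≈ᴹ lincomb (λ i → sum (λ j → a j * b j i)) Π
    lincomb-lincomb {zero} a b = ≈ᴹ-sym (≈ᴹ-trans
      (Sumᴹ.sum-cong-≋ (λ i → *ₗ-zeroˡ (Π i))) (Sumᴹ.sum-replicate-zero n))
    lincomb-lincomb {suc k} a b = ≈ᴹ-trans
      (+ᴹ-cong (≈ᴹ-sym (lincomb-* (a zero) (b zero) Π)) (lincomb-lincomb (a ∘ suc) (b ∘ suc)))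
      (≈ᴹ-sym (lincomb-+ (λ i → a zero * b zero i) (λ i → sum (λ j → a (suc j) * b (suc j) i)) Π))

  expand : ∀ x → ∃ λ (a : Vector Scalar n) → x ≈ᴹ lincomb a Π
  expand x =
    let k , a , v , v∈Φ , x≈ = spanning x in
    (λ i → sum (λ j → a j * Simple.coord (v∈Φ j) i)) ,
    ≈ᴹ-trans x≈ (≈ᴹ-trans (lincomb-cong (λ _ → refl) (λ j → Simple.expansion (v∈Φ j)))
      (lincomb-lincomb a (λ j → Simple.coord (v∈Φ j))))

  abstract
    -- `coord` takes a membership proof and exists on roots only. As Φ spans, every vector has some
    -- expansion in Π, and independence of Π makes the choice immaterial, so the coefficients become
    -- linear functionals on the whole space.
    coefficient : Fin n → Carrierᴹ → Scalar
    coefficient i x = proj₁ (expand x) i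

    coefficient-expansion : ∀ x → x ≈ᴹ lincomb (λ i → coefficient i x) Π
    coefficient-expansion x = proj₂ (expand x)

    coefficient-unique : ∀ {x a} → x ≈ᴹ lincomb a Π → ∀ i → coefficient i x ≈ a i
    coefficient-unique {x} x≈ = lincomb-injective (≈ᴹ-trans (≈ᴹ-sym (coefficient-expansion x)) x≈)

    coefficient-linear : ∀ i → IsLinear (coefficient i)
    coefficient-linear i = record
      { cong   = λ {x} {y} x≈y → coefficient-unique (≈ᴹ-trans x≈y (coefficient-expansion y)) i
      ; homo-+ = λ x y → coefficient-unique {a = λ i → coefficient i x + coefficient i y}
          (≈ᴹ-trans (+ᴹ-cong (coefficient-expansion x) (coefficient-expansion y))
            (≈ᴹ-sym (lincomb-+ (λ i → coefficient i x) (λ i → coefficient i y) Π))) i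
      ; homo-* = λ a x → coefficient-unique {a = λ i → a * coefficient i x}
          (≈ᴹ-trans (*ₗ-congˡ (coefficient-expansion x)) (≈ᴹ-sym (lincomb-* a (λ i → coefficient i x) Π))) i
      }

  module Coefficient i = IsLinear (coefficient-linear i)

  abstract
    coord≈coefficient : ∀ {γ} (γ∈Φ : γ ∈ Φ) i → Simple.coord γ∈Φ i ≈ coefficient i γ
    coord≈coefficient γ∈Φ i = sym (coefficient-unique (Simple.expansion γ∈Φ) i)

    coefficient-ext : ∀ {x y} → (∀ i → coefficient i x ≈ coefficient i y) → x ≈ᴹ y
    coefficient-ext h = ≈ᴹ-trans (coefficient-expansion _)
      (≈ᴹ-trans (lincomb-cong h (λ _ → ≈ᴹ-refl)) (≈ᴹ-sym (coefficient-expansion _)))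

    coefficient-same-sign : ∀ {γ} → γ ∈ Φ → (∀ i → 0# ≤ coefficient i γ) ⊎ (∀ i → coefficient i γ ≤ 0#)
    coefficient-same-sign γ∈Φ with Simple.same-sign γ∈Φ
    ... | inj₁ h = inj₁ (λ i → ≤-respʳ-≈ (coord≈coefficient γ∈Φ i) (h i))
    ... | inj₂ h = inj₂ (λ i → ≤-respˡ-≈ (coord≈coefficient γ∈Φ i) (h i))

    private
      δ : Fin n → Vector Scalar n
      δ j i with i Fin.≟ j
      ... | yes _ = 1#
      ... | no  _ = 0#

      δ-same : ∀ j → δ j j ≈ 1#
      δ-same j with j Fin.≟ j
      ... | yes _ = refl
      ... | no j≢j = contradiction ≡.refl j≢j

      δ-diff : ∀ {i j} → i ≢ j → δ j i ≈ 0#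
      δ-diff {i} {j} i≢j with i Fin.≟ j
      ... | yes i≡j = contradiction i≡j i≢j
      ... | no _ = refl

      Π≈lincomb-δ : ∀ j → Π j ≈ᴹ lincomb (δ j) Π
      Π≈lincomb-δ j = ≈ᴹ-sym (≈ᴹ-trans
        (Singletonᴹ.sum-single (λ i → δ j i *ₗ Π i) j (λ i i≢j → ≈ᴹ-trans (*ₗ-congʳ (δ-diff i≢j)) (*ₗ-zeroˡ _)))
        (≈ᴹ-trans (*ₗ-congʳ (δ-same j)) (*ₗ-identityˡ _)))
        where module Singletonᴹ = SingletonSum +ᴹ-commutativeMonoid

    coefficient-Π-same : ∀ j → coefficient j (Π j) ≈ 1#
    coefficient-Π-same j = trans (coefficient-unique (Π≈lincomb-δ j) j) (δ-same j)

    coefficient-Π-diff : ∀ {i j} → i ≢ j → coefficient i (Π j) ≈ 0#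
    coefficient-Π-diff {i} {j} i≢j = trans (coefficient-unique (Π≈lincomb-δ j) i) (δ-diff i≢j)

    coefficient-Π-nonNeg : ∀ i j → 0# ≤ coefficient i (Π j)
    coefficient-Π-nonNeg i j with i Fin.≟ j
    ... | yes ≡.refl = ≤-respʳ-≈ (sym (coefficient-Π-same i)) (<⇒≤ 0<1)
    ... | no i≢j = ≤-reflexive (sym (coefficient-Π-diff i≢j))

  IsIntegral : Scalar → Set ℓ₁
  IsIntegral x = ∃ λ z → x ≈ fromℤ z

  private
    height : Carrierᴹ → Scalar
    height x = sum (λ i → coefficient i x)

    height-linear : IsLinear height
    height-linear = sum-linear coefficient coefficient-linear
    module Height = IsLinear height-linear

  open Descent height-linear

  abstract
    1-integral : IsIntegral 1#
    1-integral = + 1 , sym (+-identityʳ 1#)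

    coefficient-Π-integral : ∀ i j → IsIntegral (coefficient i (Π j))
    coefficient-Π-integral i j with i Fin.≟ j
    ... | yes ≡.refl = + 1 , trans (coefficient-Π-same i) (proj₂ 1-integral)
    ... | no i≢j = + 0 , coefficient-Π-diff i≢j

    height-Π : ∀ j → height (Π j) ≈ 1#
    height-Π j = trans (sum-single (λ i → coefficient i (Π j)) j (λ i i≢j → coefficient-Π-diff i≢j))
      (coefficient-Π-same j)

    -- Otherwise the expansion of γ in Π would make ⟪ γ , γ ⟫ a sum of nonpositive terms.
    exists-positive-pairing : ∀ {γ} → γ ∈ Φ → (∀ i → 0# ≤ coefficient i γ) → ∃ λ j → 0# < ⟪ γ , Π j ⟫
    exists-positive-pairing {γ} γ∈Φ γ≥0 with Fin.any? (λ j → 0# <? ⟪ γ , Π j ⟫)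
    ... | yes found = found
    ... | no none = contradiction (≤-respˡ-≈ (sym (trans (Pairingʳ.cong γ (coefficient-expansion γ))
        (Pairingʳ.homo-lincomb γ (λ i → coefficient i γ) Π)))
        (sum-nonPos _ (λ i → *-nonPos (γ≥0 i) (≮⇒≥ (λ h → none (i , h)))))) (norm-root γ∈Φ)

    -- Such a root is a multiple of `Π j`, and reducedness leaves only the factors 1 and -1.
    multiple-integral : ∀ {γ j} → γ ∈ Φ → (∀ i → i ≢ j → coefficient i γ ≈ 0#) →
                        ∀ i → IsIntegral (coefficient i γ)
    multiple-integral {γ} {j} γ∈Φ h i with i Fin.≟ j
    ... | no i≢j = + 0 , h i i≢j
    ... | yes ≡.refl with reduced a (Simple.root i) (∈-resp (coefficient-ext γ≈) γ∈Φ)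
      where
      a : Scalar
      a = coefficient i γ
      γ≈ : ∀ k → coefficient k γ ≈ coefficient k (a *ₗ Π i)
      γ≈ k with k Fin.≟ i
      ... | yes ≡.refl = sym (trans (Coefficient.homo-* i a _)
        (trans (*-congˡ (coefficient-Π-same i)) (*-identityʳ a)))
      ... | no k≢i = trans (h k k≢i) (sym (trans (Coefficient.homo-* k a _)
        (trans (*-congˡ (coefficient-Π-diff k≢i)) (zeroʳ a))))
    ... | inj₁ ≈1 = + 1 , trans ≈1 (proj₂ 1-integral)
    ... | inj₂ ≈-1 = -[1+ 0 ] , trans ≈-1 (-‿cong (proj₂ 1-integral))

    -- Induction on the height: subtract a simple root `Π j` that pairs positively with γ. If the
    -- difference is a negative root, the coefficients of γ other than the one at `j`, being
    -- unchanged, are both nonnegative and nonpositive, so `multiple-integral` applies.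
    positive-integral : ∀ γ → Acc _≺_ γ → γ ∈ Φ → (∀ i → 0# ≤ coefficient i γ) →
                        ∀ i → IsIntegral (coefficient i γ)
    positive-integral γ (acc rec) γ∈Φ γ≥0 i with exists-positive-pairing γ∈Φ γ≥0
    ... | j , 0<γΠj with difference γ∈Φ (Simple.root j) 0<γΠj
    ... | inj₁ γ≈Πj = let z , ≈z = coefficient-Π-integral i j in z , trans (Coefficient.cong i γ≈Πj) ≈z
    ... | inj₂ γ-Πj∈Φ with coefficient-same-sign γ-Πj∈Φ
    ... | inj₂ ≤0 = multiple-integral γ∈Φ (λ k k≢j → antisym
          (≤-respˡ-≈ (trans (Coefficient.homo-- k γ (Π j)) (trans (+-congˡ (-‿cong (coefficient-Π-diff k≢j)))
            (solve 1 (λ x → x :- con (+ 0) := x) refl _))) (≤0 k)) (γ≥0 k)) i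
    ... | inj₁ ≥0 =
      let z , ≈z = positive-integral (γ -ᴹ Π j) (rec (γ-Πj∈Φ , lower)) γ-Πj∈Φ ≥0 i
          w , ≈w = coefficient-Π-integral i j in
      z ℤ.+ w , (begin
        coefficient i γ
          ≈⟨ solve 2 (λ x y → x := (x :- y) :+ y) refl _ (coefficient i (Π j)) ⟩
        coefficient i γ + - coefficient i (Π j) + coefficient i (Π j)
          ≈⟨ +-cong (trans (sym (Coefficient.homo-- i γ (Π j))) ≈z) ≈w ⟩
        fromℤ z + fromℤ w
          ≈⟨ fromℤ-+ z w ⟨
        fromℤ (z ℤ.+ w) ∎)
      where
      lower : height (γ -ᴹ Π j) < height γ
      lower = <-≤-trans (x<x+1 _) (≤-reflexive (trans (+-cong (Height.homo-- γ (Π j)) (sym (height-Π j)))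
        (solve 2 (λ x y → (x :- y) :+ y := x) refl _ _)))

    -- Over a non-Archimedean field, being an integer is not decidable for
    -- arbitrary scalars; integrality of the coefficients is what makes
    -- Φ_{S,ℤβ} a decidable, hence finite, subset of Φ.
    coefficient-integral : ∀ {γ} → γ ∈ Φ → ∀ i → IsIntegral (coefficient i γ)
    coefficient-integral {γ} γ∈Φ i with coefficient-same-sign γ∈Φ
    ... | inj₁ γ≥0 = positive-integral γ (≺-wellFounded γ) γ∈Φ γ≥0 i
    ... | inj₂ γ≤0 =
      let z , ≈z = positive-integral (-ᴹ γ) (≺-wellFounded _) (neg-∈ γ∈Φ)
            (λ k → ≤-respʳ-≈ (sym (Coefficient.homo-neg k γ)) (neg-nonNeg (γ≤0 k))) i in
      ℤ.- z , (begin
        coefficient i γ            ≈⟨ solve 1 (λ x → x := :- (:- x)) refl _ ⟩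
        - - coefficient i γ        ≈⟨ -‿cong (trans (sym (Coefficient.homo-neg i γ)) ≈z) ⟩
        - fromℤ z                  ≈⟨ fromℤ-neg z ⟨
        fromℤ (ℤ.- z)              ∎)

-- Levels with respect to S, antidominance, extremal roots of level 1.

module Levi {c ℓ₁ ℓ₂ e ℓ p} {K : OrderedField c ℓ₁ ℓ₂} (E : EuclideanSpace K e ℓ)
  (Φ : Pred (EuclideanSpace.Carrierᴹ E) p)
  (isRootSystem : RootSystems.IsRootSystem E Φ) (spanning : RootSystems.Spanning E Φ)
  {n : ℕ} (Π : Vector (EuclideanSpace.Carrierᴹ E) n) (Π-simple : RootSystems.IsSimpleSystem E Φ Π)
  (S : Subset n)
  where

  open OrderedField K hiding (zero) renaming (Carrier to Scalar)
  open OrderedFieldProperties K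
  open EuclideanSpace E
  open EuclideanProperties E
  open RootSystems E
  open IsRootSystem isRootSystem
  open RootSystemProperties E Φ isRootSystem
  open Coordinates E Φ isRootSystem spanning Π Π-simple
  open SemiringSum semiring using (sum)
  open SetoidReasoning setoid

  -- Used for Π ∖ S and for its negative, which turns maxima into minima.
  record LeviBasis (l : ℕ) : Set (c ⊔ ℓ₁ ⊔ ℓ₂ ⊔ e ⊔ ℓ ⊔ p) where
    field
      Λ             : Vector Carrierᴹ l
      dual          : Fin l → Carrierᴹ → Scalar
      dual-linear   : ∀ j → IsLinear (dual j)
      Λ-root        : ∀ j → Λ j ∈ Φ
      dual-Λ-same   : ∀ j → dual j (Λ j) ≈ 1#
      dual-Λ-diff   : ∀ {i j} → i ≢ j → dual i (Λ j) ≈ 0#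
      coefficient-Λ : ∀ j i → i ∈ˢ S → coefficient i (Λ j) ≈ 0#
      Λ-expansion   : ∀ {x} → (∀ i → i ∈ˢ S → coefficient i x ≈ 0#) → x ≈ᴹ lincomb (λ j → dual j x) Λ
      Λ-same-sign   : ∀ {γ} → γ ∈ Φ → (∀ i → i ∈ˢ S → coefficient i γ ≈ 0#) →
                      (∀ j → 0# ≤ dual j γ) ⊎ (∀ j → dual j γ ≤ 0#)

  module Levels (β : Carrierᴹ) (i₀ : Fin n) (i₀∈S : i₀ ∈ˢ S) (β≉0 : coefficient i₀ β ≉ 0#) where

    -- Level 1 cuts Φ_{S,β} out of Φ and the integral levels cut out Φ_{S,ℤβ}. Scalar levels on
    -- arbitrary vectors make the notion linear, so that it also applies to the orthogonal component
    -- `v` and to multiples by Cartan numbers.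
    HasLevel : Scalar → Carrierᴹ → Set ℓ₁
    HasLevel t x = ∀ i → i ∈ˢ S → coefficient i x ≈ t * coefficient i β

    hasLevel? : ∀ t → Decidable (HasLevel t)
    hasLevel? t x = Fin.all? (λ i → (i ∈ˢ? S) →-dec (coefficient i x ≈? t * coefficient i β))

    abstract
      level-resp : ∀ {t x y} → x ≈ᴹ y → HasLevel t x → HasLevel t y
      level-resp x≈y h i i∈S = trans (Coefficient.cong i (≈ᴹ-sym x≈y)) (h i i∈S)

      level-≈ : ∀ {s t x} → s ≈ t → HasLevel s x → HasLevel t x
      level-≈ s≈t h i i∈S = trans (h i i∈S) (*-congʳ s≈t)

      level-0 : ∀ {x} → HasLevel 0# x → ∀ i → i ∈ˢ S → coefficient i x ≈ 0#
      level-0 h i i∈S = trans (h i i∈S) (zeroˡ _)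

      0-level : ∀ {x} → (∀ i → i ∈ˢ S → coefficient i x ≈ 0#) → HasLevel 0# x
      0-level h i i∈S = trans (h i i∈S) (sym (zeroˡ _))

      level-* : ∀ a {t x} → HasLevel t x → HasLevel (a * t) (a *ₗ x)
      level-* a h i i∈S = trans (Coefficient.homo-* i a _) (trans (*-congˡ (h i i∈S)) (sym (*-assoc _ _ _)))

      level-- : ∀ {s t x y} → HasLevel s x → HasLevel t y → HasLevel (s + - t) (x -ᴹ y)
      level-- {s} {t} {x} {y} hx hy i i∈S = trans (Coefficient.homo-- i x y)
        (trans (+-cong (hx i i∈S) (-‿cong (hy i i∈S)))
        (solve 3 (λ s t b → s :* b :- t :* b := (s :- t) :* b) refl s t (coefficient i β)))

      level-neg : ∀ {s x} → HasLevel s x → HasLevel (- s) (-ᴹ x)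
      level-neg {s} {x} hx i i∈S = trans (Coefficient.homo-neg i x) (trans (-‿cong (hx i i∈S))
        (solve 2 (λ s b → :- (s :* b) := (:- s) :* b) refl s (coefficient i β)))

      -- This uses that the support of β meets S: if β vanished on S, all level conditions would
      -- coincide. Levels are compared at `i₀`, where β has a nonzero coefficient.
      level-unique : ∀ {s t x} → HasLevel s x → HasLevel t x → s ≈ t
      level-unique hs ht = *-cancelˡ β≉0 (trans (*-comm _ _)
        (trans (trans (sym (hs i₀ i₀∈S)) (ht i₀ i₀∈S)) (*-comm _ _)))

      β-level : HasLevel 1# β
      β-level i _ = sym (*-identityˡ _)

    module LeviBasisProperties {l} (B : LeviBasis l) where

      open LeviBasis B
      private module Dual j = IsLinear (dual-linear j)

      abstract
        dual-lincomb : ∀ a j → dual j (lincomb a Λ) ≈ a j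
        dual-lincomb a j = trans (Dual.homo-lincomb j a Λ) (trans
          (sum-single (λ i → a i * dual j (Λ i)) j
            (λ i i≢j → trans (*-congˡ (dual-Λ-diff (i≢j ∘ ≡.sym))) (zeroʳ _)))
          (trans (*-congˡ (dual-Λ-same j)) (*-identityʳ _)))

        Λ-independent : LinearlyIndependent Λ
        Λ-independent a h j = trans (sym (dual-lincomb a j)) (trans (Dual.cong j h) (Dual.homo-0 j))

        coefficient-lincomb-Λ : ∀ a i → i ∈ˢ S → coefficient i (lincomb a Λ) ≈ 0#
        coefficient-lincomb-Λ a i i∈S = trans (Coefficient.homo-lincomb i a Λ)
          (sum-zero _ (λ j → trans (*-congˡ (coefficient-Λ j i i∈S)) (zeroʳ _)))

        dual-Λ-nonNeg : ∀ i j → 0# ≤ dual i (Λ j)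
        dual-Λ-nonNeg i j with i Fin.≟ j
        ... | yes ≡.refl = ≤-respʳ-≈ (sym (dual-Λ-same i)) (<⇒≤ 0<1)
        ... | no i≢j = ≤-reflexive (sym (dual-Λ-diff i≢j))

        level-Λ : ∀ j → HasLevel 0# (Λ j)
        level-Λ j = 0-level (coefficient-Λ j)

        level--0 : ∀ {t x y} → HasLevel t x → HasLevel 0# y → HasLevel t (x -ᴹ y)
        level--0 hx hy = level-≈ (solve 1 (λ t → t :- con (+ 0) := t) refl _) (level-- hx hy)

        level--same : ∀ {t x y} → HasLevel t x → HasLevel t y → HasLevel 0# (x -ᴹ y)
        level--same hx hy = level-≈ (-‿inverseʳ _) (level-- hx hy)

        level≉0⇒≉Λ : ∀ {t γ} → t ≉ 0# → HasLevel t γ → ∀ j → γ ≉ᴹ Λ j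
        level≉0⇒≉Λ t≉0 hγ j γ≈Λ = t≉0 (level-unique hγ (level-resp (≈ᴹ-sym γ≈Λ) (level-Λ j)))

        -- A positive pairing would make `Λ i` equal to `Λ j`, or their difference a root of level 0
        -- with the coordinates 1 and -1, against `Λ-same-sign`.
        Λ-obtuse : ∀ i j → i ≢ j → ⟪ Λ i , Λ j ⟫ ≤ 0#
        Λ-obtuse i j i≢j = ≮⇒≥ (λ 0<ij → absurd (difference (Λ-root i) (Λ-root j) 0<ij))
          where
          dual-i : dual i (Λ i -ᴹ Λ j) ≈ 1#
          dual-i = trans (Dual.homo-- i _ _) (trans (+-cong (dual-Λ-same i) (-‿cong (dual-Λ-diff i≢j)))
            (solve 1 (λ t → t :- con (+ 0) := t) refl _))
          dual-j : dual j (Λ i -ᴹ Λ j) ≈ - 1#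
          dual-j = trans (Dual.homo-- j _ _) (trans (+-cong (dual-Λ-diff (i≢j ∘ ≡.sym)) (-‿cong (dual-Λ-same j)))
            (+-identityˡ _))
          absurd : ¬ (Λ i ≈ᴹ Λ j ⊎ Λ i -ᴹ Λ j ∈ Φ)
          absurd (inj₁ Λi≈Λj) = 0≉1 (trans (sym (dual-Λ-diff i≢j))
            (trans (Dual.cong i (≈ᴹ-sym Λi≈Λj)) (dual-Λ-same i)))
          absurd (inj₂ ∈Φ) with Λ-same-sign ∈Φ (level-0 (level--same (level-Λ i) (level-Λ j)))
          ... | inj₁ ≥0 = 0<1 (0≤y-x⇒x≤y (≤-respʳ-≈ (trans dual-j (sym (+-identityˡ _))) (≥0 j)))
          ... | inj₂ ≤0 = 0<1 (≤-respˡ-≈ dual-i (≤0 i))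

      Antidominant : Carrierᴹ → Set ℓ₂
      Antidominant x = ∀ j → ⟪ x , Λ j ⟫ ≤ 0#

      antidominant? : ∀ x → (∃ λ j → 0# < ⟪ x , Λ j ⟫) ⊎ Antidominant x
      antidominant? x with Fin.any? (λ j → 0# <? ⟪ x , Λ j ⟫)
      ... | yes found = inj₁ found
      ... | no none   = inj₂ (λ j → ≮⇒≥ (λ h → none (j , h)))

      v : Carrierᴹ
      v = β -ᴹ lincomb (proj₁ (projection Λ β)) Λ

      abstract
        v-orthogonal : ∀ j → ⟪ v , Λ j ⟫ ≈ 0#
        v-orthogonal j = trans (Pairingˡ.homo-- _ _ _)
          (trans (+-congˡ (-‿cong (proj₂ (projection Λ β) j))) (-‿inverseʳ _))

        v-level : HasLevel 1# v
        v-level = level--0 β-level (0-level (coefficient-lincomb-Λ _))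

        -- `v` differs from β by a vector of level 0, so it keeps the level 1, whereas the zero
        -- vector has level 0.
        v-pos : 0# < ⟪ v , v ⟫
        v-pos = norm-pos λ v≈0 → 0≉1 (level-unique
          (level-resp (≈ᴹ-sym v≈0) (0-level (λ i _ → Coefficient.homo-0 i))) v-level)

        -- `x` and `v` differ by a vector of level 0; it lies in the span of `Λ`, to which `v` is
        -- orthogonal.
        level-1-orthogonal : ∀ {x} → HasLevel 1# x → ⟪ v , x ⟫ ≈ ⟪ v , v ⟫
        level-1-orthogonal {x} hx = x-y≈0⇒x≈y (begin
          ⟪ v , x ⟫ + - ⟪ v , v ⟫
            ≈⟨ Pairingʳ.homo-- v x v ⟨
          ⟪ v , x -ᴹ v ⟫
            ≈⟨ Pairingʳ.cong v (Λ-expansion (level-0 (level--same hx v-level))) ⟩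
          ⟪ v , lincomb (λ j → dual j (x -ᴹ v)) Λ ⟫
            ≈⟨ Pairingʳ.homo-lincomb v _ Λ ⟩
          sum (λ j → dual j (x -ᴹ v) * ⟪ v , Λ j ⟫)
            ≈⟨ sum-zero _ (λ j → trans (*-congˡ (v-orthogonal j)) (zeroʳ _)) ⟩
          0# ∎)

        antidominant-pairing : ∀ {s γ m} → 0# < s → HasLevel s γ → HasLevel 1# m →
                               Antidominant γ → Antidominant m → 0# < ⟪ γ , m ⟫
        antidominant-pairing {s} {γ} {m} 0<s hγ hm γ-anti m-anti = <-≤-trans
          (+-pos (*-pos 0<s v-pos)
            (sum-nonNeg _ (λ j → nonPos-*-nonPos (d≤0 j) (≤-respˡ-≈ (⟪⟫-sym m (Λ j)) (m-anti j)))))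
          (≤-reflexive (begin
            s * ⟪ v , v ⟫ + sum (λ j → dual j y * ⟪ Λ j , m ⟫)
              ≈⟨ +-cong (*-congˡ (sym (level-1-orthogonal hm))) (sym (Pairingˡ.homo-lincomb m _ Λ)) ⟩
            s * ⟪ v , m ⟫ + ⟪ lincomb (λ j → dual j y) Λ , m ⟫
              ≈⟨ +-congˡ (Pairingˡ.cong m y≈) ⟨
            s * ⟪ v , m ⟫ + ⟪ y , m ⟫
              ≈⟨ +-congˡ (y-pairing m) ⟩
            s * ⟪ v , m ⟫ + (⟪ γ , m ⟫ + - (s * ⟪ v , m ⟫))
              ≈⟨ solve 2 (λ a b → a :+ (b :- a) := b) refl (s * ⟪ v , m ⟫) ⟪ γ , m ⟫ ⟩
            ⟪ γ , m ⟫ ∎))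
          where
          y : Carrierᴹ
          -- The component of γ along the span of `Λ`. Only γ is split: the nonpositive coordinates
          -- of `y` are paired with the nonpositive products of the `Λ j` with the undivided `m`.
          y = γ -ᴹ s *ₗ v
          y-level : HasLevel 0# y
          y-level = level--same hγ (level-≈ (*-identityʳ s) (level-* s v-level))
          y≈ : y ≈ᴹ lincomb (λ j → dual j y) Λ
          y≈ = Λ-expansion (level-0 y-level)
          y-pairing : ∀ x → ⟪ y , x ⟫ ≈ ⟪ γ , x ⟫ + - (s * ⟪ v , x ⟫)
          y-pairing x = trans (Pairingˡ.homo-- x γ (s *ₗ v)) (+-congˡ (-‿cong (⟪⟫-* s v x)))
          y-anti : ∀ j → ⟪ lincomb (λ j → dual j y) Λ , Λ j ⟫ ≤ 0#
          y-anti j = ≤-respˡ-≈ (sym (begin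
            ⟪ lincomb (λ j → dual j y) Λ , Λ j ⟫        ≈⟨ Pairingˡ.cong (Λ j) y≈ ⟨
            ⟪ y , Λ j ⟫                                ≈⟨ y-pairing (Λ j) ⟩
            ⟪ γ , Λ j ⟫ + - (s * ⟪ v , Λ j ⟫)          ≈⟨ +-congˡ (-‿cong (trans (*-congˡ (v-orthogonal j)) (zeroʳ s))) ⟩
            ⟪ γ , Λ j ⟫ + - 0#                         ≈⟨ solve 1 (λ t → t :- con (+ 0) := t) refl ⟪ γ , Λ j ⟫ ⟩
            ⟪ γ , Λ j ⟫                                ∎)) (γ-anti j)
          d≤0 : ∀ j → dual j y ≤ 0#
          d≤0 = antidominant⇒nonPos Λ Λ-independent Λ-obtuse _ y-anti

      -- All that the order, the simple systems and the lengths require of `m`. At level 1, `least`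
      -- gives extremality within Φ[S,β]; at higher levels it says that γ minus the multiple of `m`
      -- of the same level has nonnegative Λ-coordinates. The index `suc k` leaves out level 0.
      record Extremal (m : Carrierᴹ) : Set (c ⊔ ℓ₁ ⊔ ℓ₂ ⊔ e ⊔ ℓ ⊔ p) where
        field
          root  : m ∈ Φ
          level : HasLevel 1# m
          least : ∀ k {γ} → γ ∈ Φ → HasLevel (fromℤ (+ suc k)) γ →
                  ∀ j → fromℤ (+ suc k) * dual j m ≤ dual j γ
          norm  : ∀ {γ} → γ ∈ Φ → HasLevel 1# γ → ⟪ γ , γ ⟫ ≤ ⟪ m , m ⟫

      extremal-resp : ∀ {m m′} → m ≈ᴹ m′ → Extremal m → Extremal m′
      extremal-resp m≈m′ ext = record
        { root  = ∈-resp m≈m′ root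
        ; level = level-resp m≈m′ level
        ; least = λ k γ∈Φ hγ j → ≤-respˡ-≈ (*-congˡ (Dual.cong j m≈m′)) (least k γ∈Φ hγ j)
        ; norm  = λ γ∈Φ hγ → ≤-respʳ-≈ (⟪⟫-cong m≈m′ m≈m′) (norm γ∈Φ hγ)
        }
        where open Extremal ext

      private
        height : Carrierᴹ → Scalar
        height x = sum (λ j → dual j x)

        height-linear : IsLinear height
        height-linear = sum-linear dual dual-linear

        module Height = IsLinear height-linear

      open Descent height-linear

      abstract
        height-Λ : ∀ j → height (Λ j) ≈ 1#
        height-Λ j = trans (sum-single (λ i → dual i (Λ j)) j (λ i i≢j → dual-Λ-diff i≢j)) (dual-Λ-same j)

        -- A general factor `a` is allowed because reflecting in `Λ j` subtracts a positive Cartan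
        -- number times `Λ j`.
        height-lower : ∀ {a} → 0# < a → ∀ γ j → height (γ -ᴹ a *ₗ Λ j) < height γ
        height-lower {a} 0<a γ j γ≤ = 0<a (≤-respˡ-≈ (begin
          height γ + - (height γ + - (a * height (Λ j)))
            ≈⟨ solve 2 (λ x y → x :- (x :- y) := y) refl _ _ ⟩
          a * height (Λ j)
            ≈⟨ trans (*-congˡ (height-Λ j)) (*-identityʳ a) ⟩
          a ∎)
          (0≤y-x⇒x≤y (≤-respʳ-≈ (begin
            height (γ -ᴹ a *ₗ Λ j) + - height γ
              ≈⟨ +-congʳ (trans (Height.homo-- γ _) (+-congˡ (-‿cong (Height.homo-* a (Λ j))))) ⟩
            height γ + - (a * height (Λ j)) + - height γ
              ≈⟨ solve 2 (λ x y → (x :- y) :- x := con (+ 0) :- (x :- (x :- y))) refl _ _ ⟩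
            0# + - (height γ + - (height γ + - (a * height (Λ j)))) ∎) (x≤y⇒0≤y-x γ≤))))

        height--Λ : ∀ γ j → height (γ -ᴹ Λ j) < height γ
        height--Λ γ j = ≤-<-trans (≤-reflexive (Height.cong (+ᴹ-congˡ (-ᴹ‿cong (≈ᴹ-sym (*ₗ-identityˡ (Λ j)))))))
          (height-lower 0<1 γ j)

      module Minimal {m} (m∈Φ : m ∈ Φ) (hm : HasLevel 1# m)
        (lowest : ∀ {γ} → γ ∈ Φ → HasLevel 1# γ → height m ≤ height γ) where

        abstract
          -- If `m` paired positively with `Λ j`, then `m -ᴹ Λ j` would be a root of the same level
          -- and of smaller height; the levels exclude `m ≈ᴹ Λ j`.
          antidominant : Antidominant m
          antidominant j = ≮⇒≥ (λ 0<mΛ → absurd (difference m∈Φ (Λ-root j) 0<mΛ))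
            where
            absurd : ¬ (m ≈ᴹ Λ j ⊎ m -ᴹ Λ j ∈ Φ)
            absurd (inj₁ m≈Λ) = level≉0⇒≉Λ (λ 1≈0 → 0≉1 (sym 1≈0)) hm j m≈Λ
            absurd (inj₂ ∈Φ) = height--Λ m j (lowest ∈Φ (level--0 hm (level-Λ j)))

          -- A nested induction, on the level outside and on the height inside: subtracting some
          -- `Λ i` keeps the level and lowers the height, while subtracting `m` lowers the level but
          -- may raise the height, as the height of `m` can be negative.
          least : ∀ k {γ} → Acc _≺_ γ → γ ∈ Φ → HasLevel (fromℤ (+ suc k)) γ →
                  ∀ j → fromℤ (+ suc k) * dual j m ≤ dual j γ
          least k {γ} (acc rec) γ∈Φ hγ j with antidominant? γ
          least k {γ} (acc rec) γ∈Φ hγ j | inj₁ (i , 0<γΛ) with difference γ∈Φ (Λ-root i) 0<γΛ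
          ... | inj₁ γ≈Λ = contradiction γ≈Λ (level≉0⇒≉Λ (<⇒≉ (fromℕ-pos k)) hγ i)
          ... | inj₂ γ-Λ∈Φ = ≤-trans
                (least k (rec (γ-Λ∈Φ , height--Λ γ i)) γ-Λ∈Φ (level--0 hγ (level-Λ i)) j)
                (0≤y-x⇒x≤y (≤-respʳ-≈ (begin
                  dual j (Λ i)
                    ≈⟨ solve 2 (λ x y → y := x :- (x :- y)) refl _ _ ⟩
                  dual j γ + - (dual j γ + - dual j (Λ i))
                    ≈⟨ +-congˡ (-‿cong (Dual.homo-- j γ (Λ i))) ⟨
                  dual j γ + - dual j (γ -ᴹ Λ i) ∎) (dual-Λ-nonNeg j i)))
          least k {γ} (acc rec) γ∈Φ hγ j | inj₂ γ-anti =
            conclude (difference γ∈Φ m∈Φ (antidominant-pairing (fromℕ-pos k) hγ hm γ-anti antidominant))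
            where
            remainder : γ -ᴹ m ∈ Φ → ∀ k → HasLevel (fromℤ (+ suc k)) γ →
                        fromℤ (+ k) * dual j m ≤ dual j (γ -ᴹ m)
            -- The difference has level 0, so its Λ-coordinates share a sign. If they are
            -- nonpositive, the minimal height of `m` keeps their sum from being negative, and all
            -- of them vanish.
            remainder γ-m∈Φ zero hγ = ≤-respˡ-≈ (sym (zeroˡ _)) (nonNeg
                (Λ-same-sign γ-m∈Φ (level-0 (level--same (level-≈ (+-identityʳ 1#) hγ) hm))))
              where
              nonNeg : (∀ j → 0# ≤ dual j (γ -ᴹ m)) ⊎ (∀ j → dual j (γ -ᴹ m) ≤ 0#) → 0# ≤ dual j (γ -ᴹ m)
              nonNeg (inj₁ ≥0) = ≥0 j
              nonNeg (inj₂ ≤0) = sum-nonPos-≥0 _ ≤0 (≤-respʳ-≈ (sym (Height.homo-- γ m))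
                (x≤y⇒0≤y-x (lowest γ∈Φ (level-≈ (+-identityʳ 1#) hγ)))) j
            -- The level falls from `k + 2` to `k + 1`, so the induction on the height may start
            -- afresh.
            remainder γ-m∈Φ (suc k) hγ = least k (≺-wellFounded _) γ-m∈Φ
              (level-≈ (solve 2 (λ o k → (o :+ k) :- o := k) refl 1# (fromℤ (+ suc k))) (level-- hγ hm)) j

            conclude : γ ≈ᴹ m ⊎ γ -ᴹ m ∈ Φ → fromℤ (+ suc k) * dual j m ≤ dual j γ
            conclude (inj₁ γ≈m) = ≤-reflexive (trans (*-congʳ (level-unique hγ (level-resp (≈ᴹ-sym γ≈m) hm)))
                (trans (*-identityˡ _) (Dual.cong j (≈ᴹ-sym γ≈m))))
            conclude (inj₂ γ-m∈Φ) = 0≤y-x⇒x≤y (≤-respʳ-≈ (begin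
                  dual j (γ -ᴹ m) + - (fromℤ (+ k) * dual j m)
                    ≈⟨ +-cong (Dual.homo-- j γ m) (-‿cong refl) ⟩
                  dual j γ + - dual j m + - (fromℤ (+ k) * dual j m)
                    ≈⟨ +-congʳ (+-congˡ (-‿cong (*-identityˡ _))) ⟨
                  dual j γ + - (1# * dual j m) + - (fromℤ (+ k) * dual j m)
                    ≈⟨ solve 4 (λ g o k m → g :- o :* m :- k :* m := g :- (o :+ k) :* m) refl
                         (dual j γ) 1# (fromℤ (+ k)) (dual j m) ⟩
                  dual j γ + - (fromℤ (+ suc k) * dual j m) ∎)
                (x≤y⇒0≤y-x (remainder γ-m∈Φ k hγ)))

          norm : ∀ {γ} → Acc _≺_ γ → γ ∈ Φ → HasLevel 1# γ → ⟪ γ , γ ⟫ ≤ ⟪ m , m ⟫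
          norm {γ} (acc rec) γ∈Φ hγ with antidominant? γ
          -- A reflection instead of the difference used for `least`, since it preserves the length
          -- as well as the level.
          ... | inj₁ (i , 0<γΛ) = ≤-respˡ-≈ (reflect-isometry (Λ-root i) γ)
                (norm (rec (r∈Φ , height-lower (cartan-pos (Λ-root i) 0<γΛ) γ i)) r∈Φ
                  (level--0 hγ (level-≈ (zeroʳ _) (level-* _ (level-Λ i)))))
            where
            r∈Φ : reflect (Λ i) γ ∈ Φ
            r∈Φ = reflect-closed (Λ-root i) γ∈Φ
          -- With `q` for γ - m, the difference of the squared lengths of γ and `m` is ⟪ γ , q ⟫ + ⟪
          -- m , q ⟫. Both pairings are nonpositive, as `q` is a nonnegative combination of `Λ` and
          -- both γ and `m` are antidominant.
          ... | inj₂ γ-anti = 0≤y-x⇒x≤y (≤-respʳ-≈ (begin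
              - ⟪ γ , q ⟫ + - ⟪ m , q ⟫
                ≈⟨ +-cong (-‿cong (Pairingʳ.homo-- γ γ m))
                     (-‿cong (trans (Pairingʳ.homo-- m γ m) (+-congʳ (⟪⟫-sym m γ)))) ⟩
              - (⟪ γ , γ ⟫ + - ⟪ γ , m ⟫) + - (⟪ γ , m ⟫ + - ⟪ m , m ⟫)
                ≈⟨ solve 3 (λ a b c → :- (a :- b) :- (b :- c) := c :- a) refl ⟪ γ , γ ⟫ ⟪ γ , m ⟫ ⟪ m , m ⟫ ⟩
              ⟪ m , m ⟫ + - ⟪ γ , γ ⟫ ∎)
              (+-nonNeg (neg-nonNeg (pairing-q γ γ-anti)) (neg-nonNeg (pairing-q m antidominant))))
            where
            q : Carrierᴹ
            q = γ -ᴹ m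
            q≥0 : ∀ j → 0# ≤ dual j q
            q≥0 j = ≤-respʳ-≈ (sym (Dual.homo-- j γ m)) (x≤y⇒0≤y-x (≤-respˡ-≈
              (trans (*-congʳ (+-identityʳ 1#)) (*-identityˡ _))
              (least 0 (≺-wellFounded γ) γ∈Φ (level-≈ (sym (+-identityʳ 1#)) hγ) j)))
            pairing-q : ∀ x → Antidominant x → ⟪ x , q ⟫ ≤ 0#
            pairing-q x x-anti = ≤-respˡ-≈ (sym (trans (Pairingʳ.cong x (Λ-expansion (level-0 (level--same hγ hm))))
              (Pairingʳ.homo-lincomb x _ Λ))) (sum-nonPos _ (λ j → *-nonPos (q≥0 j) (x-anti j)))

      extremal : β ∈ Φ → ∃ Extremal
      extremal β∈Φ with minimum level-resp (hasLevel? 1#) β∈Φ β-level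
      ... | m , m∈Φ , hm , lowest = m , record
        { root  = m∈Φ
        ; level = hm
        ; least = λ k → least k (≺-wellFounded _)
        ; norm  = norm (≺-wellFounded _)
        }
        where open Minimal m∈Φ hm lowest

-- The family of simple roots outside S, and its negative.

module _ {a b} {A : Set a} {B : Set b} (f : A → B) where

  -- Positions are taken in `List.map f xs` and not in `xs`, matching the index type of `Π ∖ S`
  -- without a transport along an equality of lengths.
  pick : ∀ xs → Fin (length (List.map f xs)) → A
  pick (x List.∷ xs) zero    = x
  pick (x List.∷ xs) (suc j) = pick xs j

  fromList-map : ∀ xs j → fromList (List.map f xs) j ≡ f (pick xs j)
  fromList-map (x List.∷ xs) zero    = ≡.refl
  fromList-map (x List.∷ xs) (suc j) = fromList-map xs j

  pick-All : ∀ {q} {Q : Pred A q} {xs} → All Q xs → ∀ j → Q (pick xs j)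
  pick-All (qx All.∷ _)  zero    = qx
  pick-All (_ All.∷ qxs) (suc j) = pick-All qxs j

  pick-surjective : ∀ {x xs} → x ∈ᴾ xs → ∃ λ j → pick xs j ≡ x
  pick-surjective (here ≡.refl) = zero , ≡.refl
  pick-surjective (there x∈) = let j , eq = pick-surjective x∈ in suc j , eq

  pick-injective : ∀ {xs} → Unique xs → ∀ {i j} → pick xs i ≡ pick xs j → i ≡ j
  pick-injective (_ AllPairs.∷ _)   {zero}  {zero}  _  = ≡.refl
  pick-injective (x∉ AllPairs.∷ _)  {zero}  {suc j} eq = contradiction eq (pick-All x∉ j)
  pick-injective (x∉ AllPairs.∷ _)  {suc i} {zero}  eq = contradiction (≡.sym eq) (pick-All x∉ i)
  pick-injective (_ AllPairs.∷ xs!) {suc i} {suc j} eq = ≡.cong suc (pick-injective xs! eq)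

module Parabolic {c ℓ₁ ℓ₂ e ℓ p} {K : OrderedField c ℓ₁ ℓ₂} (E : EuclideanSpace K e ℓ)
  (Φ : Pred (EuclideanSpace.Carrierᴹ E) p)
  (isRootSystem : RootSystems.IsRootSystem E Φ) (spanning : RootSystems.Spanning E Φ)
  {n : ℕ} (Π : Vector (EuclideanSpace.Carrierᴹ E) n) (Π-simple : RootSystems.IsSimpleSystem E Φ Π)
  (S : Subset n)
  where

  open OrderedField K hiding (zero) renaming (Carrier to Scalar)
  open OrderedFieldProperties K
  open EuclideanSpace E
  open EuclideanProperties E
  open RootSystems E
  open IsRootSystem isRootSystem
  open RootSystemProperties E Φ isRootSystem
  open Coordinates E Φ isRootSystem spanning Π Π-simple
  open Levi E Φ isRootSystem spanning Π Π-simple S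
  open SemiringSum semiring using (sum)
  open LeftModuleProperties leftModule using (-ᴹ-involutive)
  private module Simple = IsSimpleSystem Π-simple
  open SetoidReasoning setoid

  private
    l : ℕ
    l = length (List.map Π (outside S))

    index : Fin l → Fin n
    index = pick Π (outside S)

    Π∖S : Vector Carrierᴹ l
    Π∖S = Π ∖ S

  abstract
    Π∖S≡Π : ∀ j → Π∖S j ≡ Π (index j)
    Π∖S≡Π = fromList-map Π (outside S)

    index∉S : ∀ j → index j ∉ˢ S
    index∉S = pick-All Π (all-filter (λ i → ¬? (i ∈ˢ? S)) (List.allFin n))

    index-surjective : ∀ {i} → i ∉ˢ S → ∃ λ j → index j ≡ i
    index-surjective {i} i∉S = pick-surjective Π (∈-filter⁺ (λ i → ¬? (i ∈ˢ? S)) (∈-allFin i) i∉S)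

    index-injective : ∀ {i j} → index i ≡ index j → i ≡ j
    index-injective = pick-injective Π (filter⁺ (λ i → ¬? (i ∈ˢ? S)) (allFin⁺ n))

    coefficient-Π∖S : ∀ i j → coefficient i (Π∖S j) ≈ coefficient i (Π (index j))
    coefficient-Π∖S i j = reflexive (≡.cong (coefficient i) (Π∖S≡Π j))

    coefficient-Π∖S-S : ∀ j i → i ∈ˢ S → coefficient i (Π∖S j) ≈ 0#
    coefficient-Π∖S-S j i i∈S = trans (coefficient-Π∖S i j)
      (coefficient-Π-diff (λ { ≡.refl → index∉S j i∈S }))

    coefficient-Π∖S-same : ∀ j → coefficient (index j) (Π∖S j) ≈ 1#
    coefficient-Π∖S-same j = trans (coefficient-Π∖S (index j) j) (coefficient-Π-same (index j))

    coefficient-Π∖S-diff : ∀ {i j} → i ≢ j → coefficient (index i) (Π∖S j) ≈ 0#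
    coefficient-Π∖S-diff {i} {j} i≢j = trans (coefficient-Π∖S (index i) j)
      (coefficient-Π-diff (i≢j ∘ index-injective))

    Π∖S-expansion : ∀ {x} → (∀ i → i ∈ˢ S → coefficient i x ≈ 0#) →
                    x ≈ᴹ lincomb (λ j → coefficient (index j) x) Π∖S
    Π∖S-expansion {x} h = coefficient-ext at
      where
      d : Vector Scalar l
      d j = coefficient (index j) x
      at : ∀ i → coefficient i x ≈ coefficient i (lincomb d Π∖S)
      at i with i ∈ˢ? S
      ... | yes i∈S = trans (h i i∈S) (sym (trans (Coefficient.homo-lincomb i d Π∖S)
              (sum-zero _ (λ j → trans (*-congˡ (coefficient-Π∖S-S j i i∈S)) (zeroʳ _)))))
      ... | no i∉S with index-surjective i∉S
      ... | j , ≡.refl = sym (trans (Coefficient.homo-lincomb i d Π∖S)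
              (trans (sum-single (λ k → d k * coefficient (index j) (Π∖S k)) j
                  (λ k k≢j → trans (*-congˡ (coefficient-Π∖S-diff (k≢j ∘ ≡.sym))) (zeroʳ _)))
                (trans (*-congˡ (coefficient-Π∖S-same j)) (*-identityʳ _))))

    Π∖S-same-sign : ∀ {γ} → γ ∈ Φ →
      (∀ j → 0# ≤ coefficient (index j) γ) ⊎ (∀ j → coefficient (index j) γ ≤ 0#)
    Π∖S-same-sign γ∈Φ with coefficient-same-sign γ∈Φ
    ... | inj₁ ≥0 = inj₁ (≥0 ∘ index)
    ... | inj₂ ≤0 = inj₂ (≤0 ∘ index)

    neg-*ₗ-neg : ∀ a x → (- a) *ₗ (-ᴹ x) ≈ᴹ a *ₗ x
    neg-*ₗ-neg a x = coefficient-ext λ i → begin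
      coefficient i (- a *ₗ -ᴹ x)      ≈⟨ Coefficient.homo-* i (- a) (-ᴹ x) ⟩
      - a * coefficient i (-ᴹ x)       ≈⟨ *-congˡ (Coefficient.homo-neg i x) ⟩
      - a * - coefficient i x          ≈⟨ solve 2 (λ a x → (:- a) :* (:- x) := a :* x) refl a (coefficient i x) ⟩
      a * coefficient i x              ≈⟨ Coefficient.homo-* i a x ⟨
      coefficient i (a *ₗ x)           ∎

    neg-same-sign : ∀ {k} {f : Vector Scalar k} → (∀ i → 0# ≤ f i) ⊎ (∀ i → f i ≤ 0#) →
                    (∀ i → 0# ≤ - f i) ⊎ (∀ i → - f i ≤ 0#)
    neg-same-sign (inj₁ ≥0) = inj₂ (λ i → neg-nonPos (≥0 i))
    neg-same-sign (inj₂ ≤0) = inj₁ (λ i → neg-nonNeg (≤0 i))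

  Π∖S-basis : LeviBasis l
  Π∖S-basis = record
    { Λ             = Π∖S
    ; dual          = coefficient ∘ index
    ; dual-linear   = coefficient-linear ∘ index
    ; Λ-root        = λ j → ≡.subst Φ (≡.sym (Π∖S≡Π j)) (Simple.root (index j))
    ; dual-Λ-same   = coefficient-Π∖S-same
    ; dual-Λ-diff   = coefficient-Π∖S-diff
    ; coefficient-Λ = coefficient-Π∖S-S
    ; Λ-expansion   = Π∖S-expansion
    ; Λ-same-sign   = λ γ∈Φ _ → Π∖S-same-sign γ∈Φ
    }

  opposite : ∀ {k} → LeviBasis k → LeviBasis k
  opposite B = record
    { Λ             = λ j → -ᴹ Λ j
    ; dual          = λ j x → - dual j x
    ; dual-linear   = negated ∘ dual-linear
    ; Λ-root        = neg-∈ ∘ Λ-root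
    ; dual-Λ-same   = λ j → trans (neg-dual j j) (dual-Λ-same j)
    ; dual-Λ-diff   = λ {i} {j} i≢j → trans (neg-dual i j) (dual-Λ-diff i≢j)
    ; coefficient-Λ = λ j i i∈S → trans (Coefficient.homo-neg i (Λ j))
        (trans (-‿cong (coefficient-Λ j i i∈S)) -0≈0)
    ; Λ-expansion   = λ {x} h → ≈ᴹ-trans (Λ-expansion h)
        (Sumᴹ.sum-cong-≋ (λ j → ≈ᴹ-sym (neg-*ₗ-neg (dual j x) (Λ j))))
    ; Λ-same-sign   = λ γ∈Φ h → neg-same-sign (Λ-same-sign γ∈Φ h)
    }
    where
    open LeviBasis B
    module Sumᴹ = Sum +ᴹ-commutativeMonoid
    neg-dual : ∀ i j → - dual i (-ᴹ Λ j) ≈ dual i (Λ j)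
    neg-dual i j = trans (-‿cong (IsLinear.homo-neg (dual-linear i) (Λ j)))
      (solve 1 (λ x → :- (:- x) := x) refl (dual i (Λ j)))
    -0≈0 : - 0# ≈ 0#
    -0≈0 = solve 0 (:- con (+ 0) := con (+ 0)) refl

  -- The two slices: subsystem, interval, simple systems, recovery of Φ[S,β].

  module Slices {β} (β∈Φ⁺ : Simple.Positive β) (i₀ : Fin n) (i₀∈S : i₀ ∈ˢ S)
    (i₀∈Supp : Simple.Supp (proj₁ β∈Φ⁺) i₀) where

    private
      β∈Φ : β ∈ Φ
      β∈Φ = proj₁ β∈Φ⁺

    abstract
      β≉0 : coefficient i₀ β ≉ 0#
      β≉0 ≈0 = i₀∈Supp (trans (coord≈coefficient β∈Φ i₀) ≈0)

      β-pos : 0# < coefficient i₀ β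
      β-pos = ≤∧≉⇒< (≤-respʳ-≈ (coord≈coefficient β∈Φ i₀) (proj₂ β∈Φ⁺ i₀)) β≉0

    open Levels β i₀ i₀∈S β≉0

    Φ[S,β] Φ[S,ℤβ] : Pred Carrierᴹ (ℓ₁ ⊔ p)
    Φ[S,β]  = Simple.Slice S β∈Φ
    Φ[S,ℤβ] = Simple.ℤSlice S β∈Φ

    private
      module B⁺ = LeviBasisProperties Π∖S-basis
      module B⁻ = LeviBasisProperties (opposite Π∖S-basis)

    abstract
      level⇒slice : ∀ {γ} → γ ∈ Φ → HasLevel 1# γ → γ ∈ Φ[S,β]
      level⇒slice γ∈Φ hγ = γ∈Φ , λ i i∈S → trans (coord≈coefficient γ∈Φ i)
        (trans (hγ i i∈S) (trans (*-identityˡ _) (sym (coord≈coefficient β∈Φ i))))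

      slice⇒level : ∀ {γ} → γ ∈ Φ[S,β] → HasLevel 1# γ
      slice⇒level (γ∈Φ , h) i i∈S = trans (sym (coord≈coefficient γ∈Φ i))
        (trans (h i i∈S) (trans (coord≈coefficient β∈Φ i) (sym (*-identityˡ _))))

    level⇒ℤslice : ∀ {γ} → γ ∈ Φ → (k : ℤ) → HasLevel (fromℤ k) γ → γ ∈ Φ[S,ℤβ]
    level⇒ℤslice γ∈Φ k hγ = γ∈Φ , k , λ i i∈S → trans (coord≈coefficient γ∈Φ i)
      (trans (hγ i i∈S) (*-congˡ (sym (coord≈coefficient β∈Φ i))))

    abstract
      ℤslice⇒level : ∀ {γ} (γ∈ : γ ∈ Φ[S,ℤβ]) → HasLevel (fromℤ (proj₁ (proj₂ γ∈))) γ
      ℤslice⇒level (γ∈Φ , k , h) i i∈S = trans (sym (coord≈coefficient γ∈Φ i))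
        (trans (h i i∈S) (*-congˡ (coord≈coefficient β∈Φ i)))

      -- The only candidate for the level is the quotient of the integral coefficients of γ and β at
      -- `i₀`. Divisibility in ℤ finds it, and it is then tested on the whole of S.
      integral-level? : ∀ {γ} → γ ∈ Φ → Dec (∃ λ k → HasLevel (fromℤ k) γ)
      integral-level? {γ} γ∈Φ with coefficient-integral γ∈Φ i₀ | coefficient-integral β∈Φ i₀
      ... | y , ≈y | z , ≈z with z ∣? y
      ... | no z∤y = no λ (k , hγ) → z∤y (divides k (fromℤ-injective (begin
            fromℤ y                     ≈⟨ ≈y ⟨
            coefficient i₀ γ            ≈⟨ hγ i₀ i₀∈S ⟩
            fromℤ k * coefficient i₀ β  ≈⟨ *-congˡ ≈z ⟩
            fromℤ k * fromℤ z           ≈⟨ fromℤ-* k z ⟨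
            fromℤ (k ℤ.* z)             ∎)))
      ... | yes (divides q y≡qz) with hasLevel? (fromℤ q) γ
      ...   | yes hγ = yes (q , hγ)
      ...   | no ¬hγ = no λ (k , hγ) → ¬hγ (level-≈ (*-cancelˡ β≉0 (begin
              coefficient i₀ β * fromℤ k    ≈⟨ *-comm _ _ ⟩
              fromℤ k * coefficient i₀ β    ≈⟨ hγ i₀ i₀∈S ⟨
              coefficient i₀ γ              ≈⟨ ≈y ⟩
              fromℤ y                       ≡⟨ ≡.cong fromℤ y≡qz ⟩
              fromℤ (q ℤ.* z)               ≈⟨ fromℤ-* q z ⟩
              fromℤ q * fromℤ z             ≈⟨ *-congˡ ≈z ⟨
              fromℤ q * coefficient i₀ β    ≈⟨ *-comm _ _ ⟩
              coefficient i₀ β * fromℤ q    ∎)) hγ)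

      ℤslice-finite : Finite Φ[S,ℤβ]
      ℤslice-finite =
        let xs , to , from = finite-filter {Q = λ γ → ∃ λ k → HasLevel (fromℤ k) γ}
              (λ x≈y (k , h) → k , level-resp x≈y h) integral-level? in
        xs , (λ γ∈ → to (proj₁ γ∈ , proj₁ (proj₂ γ∈) , ℤslice⇒level γ∈)) ,
             (λ γ∈ → let γ∈Φ , k , h = from γ∈ in level⇒ℤslice γ∈Φ k h)

      -- Levels are linear and the Cartan number is an integer, so the level of the reflected root
      -- is again an integer.
      ℤslice-reflect : ∀ {α γ} → α ∈ Φ[S,ℤβ] → γ ∈ Φ[S,ℤβ] → reflect α γ ∈ Φ[S,ℤβ]
      ℤslice-reflect α∈@(α∈Φ , k , _) γ∈@(γ∈Φ , k′ , _) =
        let z , ≈z = crystallographic α∈Φ γ∈Φ in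
        level⇒ℤslice (reflect-closed α∈Φ γ∈Φ) (k′ ℤ.- z ℤ.* k)
          (level-≈ (begin
              fromℤ k′ + - (cartan _ _ * fromℤ k)    ≈⟨ +-congˡ (-‿cong (*-congʳ ≈z)) ⟩
              fromℤ k′ + - (fromℤ z * fromℤ k)       ≈⟨ +-congˡ (-‿cong (fromℤ-* z k)) ⟨
              fromℤ k′ + - fromℤ (z ℤ.* k)           ≈⟨ +-congˡ (fromℤ-neg (z ℤ.* k)) ⟨
              fromℤ k′ + fromℤ (ℤ.- (z ℤ.* k))       ≈⟨ fromℤ-+ k′ (ℤ.- (z ℤ.* k)) ⟨
              fromℤ (k′ ℤ.- z ℤ.* k)                 ∎)
            (level-- (ℤslice⇒level γ∈) (level-* _ (ℤslice⇒level α∈))))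

    ℤslice-neg : ∀ {γ} → γ ∈ Φ[S,ℤβ] → -ᴹ γ ∈ Φ[S,ℤβ]
    ℤslice-neg γ∈@(γ∈Φ , k , _) = level⇒ℤslice (neg-∈ γ∈Φ) (ℤ.- k)
      (level-≈ (sym (fromℤ-neg k)) (level-neg (ℤslice⇒level γ∈)))

    ℤslice-isRootSubsystem : IsRootSubsystem Φ[S,ℤβ] Φ
    ℤslice-isRootSubsystem = proj₁ , record
      { finite           = ℤslice-finite
      ; nonzero          = nonzero ∘ proj₁
      ; reduced          = λ a α∈ aα∈ → reduced a (proj₁ α∈) (proj₁ aα∈)
      ; reflect-closed   = ℤslice-reflect
      ; crystallographic = λ α∈ γ∈ → crystallographic (proj₁ α∈) (proj₁ γ∈)
      }

    abstract
      cone-coefficient : ∀ {x} → x ∈ Cone Simple.Positive → ∀ i → 0# ≤ coefficient i x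
      cone-coefficient (k , a , v , a≥0 , v>0 , x≈) i = ≤-respʳ-≈
        (sym (trans (Coefficient.cong i x≈) (Coefficient.homo-lincomb i a v)))
        (sum-nonNeg _ (λ j → *-nonNeg (a≥0 j)
          (≤-respʳ-≈ (coord≈coefficient (proj₁ (v>0 j)) i) (proj₂ (v>0 j) i))))

      ≼⇒≤ : ∀ {x y} → x Simple.≼ y → ∀ i → coefficient i x ≤ coefficient i y
      ≼⇒≤ {x} {y} x≼y i = 0≤y-x⇒x≤y (≤-respʳ-≈ (Coefficient.homo-- i y x) (cone-coefficient x≼y i))

      ≼-antisym : ∀ {x y} → x Simple.≼ y → y Simple.≼ x → x ≈ᴹ y
      ≼-antisym x≼y y≼x = coefficient-ext (λ i → antisym (≼⇒≤ x≼y i) (≼⇒≤ y≼x i))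

      Π∖S-positive : ∀ j → Π∖S j ∈ Simple.Positive
      Π∖S-positive j = Π∖S∈Φ , λ i → ≤-respʳ-≈
        (trans (sym (coefficient-Π∖S i j)) (sym (coord≈coefficient Π∖S∈Φ i)))
        (coefficient-Π-nonNeg i (index j))
        where
        Π∖S∈Φ : Π∖S j ∈ Φ
        Π∖S∈Φ = LeviBasis.Λ-root Π∖S-basis j

      -- The difference has level 0 and so lies in the span of Π ∖ S, whose members are positive
      -- roots: its coordinates outside S exhibit it as an element of the cone.
      same-level-≼ : ∀ {t x y} → HasLevel t x → HasLevel t y →
                     (∀ j → coefficient (index j) x ≤ coefficient (index j) y) → x Simple.≼ y
      same-level-≼ {x = x} {y} hx hy x≤y = l , (λ j → coefficient (index j) (y -ᴹ x)) , Π∖S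
        , (λ j → ≤-respʳ-≈ (sym (Coefficient.homo-- (index j) y x)) (x≤y⇒0≤y-x (x≤y j)))
        , Π∖S-positive
        , Π∖S-expansion (level-0 (B⁺.level--same hy hx))

      minimum-extremal : ∃ λ m → m ∈ Simple.IsMin Φ[S,β] × B⁺.Extremal m
      minimum-extremal with B⁺.extremal β∈Φ
      ... | m , ext = m , (level⇒slice root level , λ {γ} γ∈ → same-level-≼ level (slice⇒level γ∈) (λ j →
            ≤-respˡ-≈ (trans (*-congʳ (+-identityʳ 1#)) (*-identityˡ _))
              (least 0 (proj₁ γ∈) (level-≈ (sym (+-identityʳ 1#)) (slice⇒level γ∈)) j))) , ext
        where open B⁺.Extremal ext

      -- The dual coordinates of the opposite basis are negated coefficients, so `least` bounds the
      -- coefficients outside S from above.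
      maximum-extremal : ∃ λ M → M ∈ Simple.IsMax Φ[S,β] × B⁻.Extremal M
      maximum-extremal with B⁻.extremal β∈Φ
      ... | M , ext = M , (level⇒slice root level , λ {γ} γ∈ → same-level-≼ (slice⇒level γ∈) level (λ j →
            0≤y-x⇒x≤y (≤-respʳ-≈ (solve 2 (λ x y → :- x :- :- y := y :- x) refl _ _)
              (x≤y⇒0≤y-x (≤-respˡ-≈ (trans (*-congʳ (+-identityʳ 1#)) (*-identityˡ _))
                (least 0 (proj₁ γ∈) (level-≈ (sym (+-identityʳ 1#)) (slice⇒level γ∈)) j)))))) , ext
        where open B⁻.Extremal ext

      -- Extremality is established for one constructed root, but is needed for any minimum;
      -- antisymmetry of `≼` identifies the two up to `≈ᴹ`.
      min⇒extremal : ∀ {m} → m ∈ Simple.IsMin Φ[S,β] → B⁺.Extremal m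
      min⇒extremal (m∈ , m≼) =
        let m′ , (m′∈ , m′≼) , ext = minimum-extremal in B⁺.extremal-resp (≼-antisym (m′≼ m∈) (m≼ m′∈)) ext

      max⇒extremal : ∀ {M} → M ∈ Simple.IsMax Φ[S,β] → B⁻.Extremal M
      max⇒extremal (M∈ , ≼M) =
        let M′ , (M′∈ , ≼M′) , ext = maximum-extremal in B⁻.extremal-resp (≼-antisym (≼M M′∈) (≼M′ M∈)) ext

      -- The sign of a root is decided at `i₀`, where γ shares the strictly positive coefficient of
      -- β.
      slice-positive : Φ[S,β] ⊆ Simple.Positive
      slice-positive {γ} γ∈@(γ∈Φ , _) with Simple.same-sign γ∈Φ
      ... | inj₁ ≥0 = γ∈Φ , ≥0
      ... | inj₂ ≤0 = contradiction (≤-respˡ-≈ (trans (coord≈coefficient γ∈Φ i₀)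
            (trans (slice⇒level γ∈ i₀ i₀∈S) (*-identityˡ _))) (≤0 i₀)) β-pos

      slice-interval : Simple.IsInterval Φ[S,β]
      slice-interval = slice-positive ,
        let m , min , _ = minimum-extremal
            M , max , _ = maximum-extremal in
        -- The order implies comparison of all coefficients, and `m` and `M` both agree with β on S,
        -- so the S-coefficients of γ are squeezed to those of β.
        m , M , min , max , λ γ>0 m≼γ γ≼M → level⇒slice (proj₁ γ>0) λ i i∈S → antisym
          (≤-respʳ-≈ (slice⇒level (proj₁ max) i i∈S) (≼⇒≤ γ≼M i))
          (≤-respˡ-≈ (slice⇒level (proj₁ min) i i∈S) (≼⇒≤ m≼γ i))

      min-max-norm : ∀ m M → m ∈ Simple.IsMin Φ[S,β] → M ∈ Simple.IsMax Φ[S,β] → ⟪ m , m ⟫ ≈ ⟪ M , M ⟫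
      min-max-norm m M min max = antisym
        (B⁻.Extremal.norm (max⇒extremal max) (proj₁ (proj₁ min)) (slice⇒level (proj₁ min)))
        (B⁺.Extremal.norm (min⇒extremal min) (proj₁ (proj₁ max)) (slice⇒level (proj₁ max)))

    module _ {k} (B : LeviBasis k) where

      open LeviBasis B
      open LeviBasisProperties B
      private module Dual j = IsLinear (dual-linear j)

      module _ {m} (ext : Extremal m) where

        open Extremal ext

        private
          rest : ℤ → Carrierᴹ → Carrierᴹ
          rest z γ = γ -ᴹ fromℤ z *ₗ m

          -- `m` has level 1 and `Λ` has level 0, so the coordinate at `m` must be the level `z`
          -- itself.
          coordinates : ℤ → Carrierᴹ → Vector Scalar (suc k)
          coordinates z γ = fromℤ z ∷ (λ j → dual j (rest z γ))

        abstract
          -- The coefficient at `i₀` vanishes on `Λ` but not on `m`, which isolates the first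
          -- scalar; the dual functionals then isolate the others.
          extremal-independent : LinearlyIndependent (m ∷ Λ)
          extremal-independent a h = λ where
              zero    → a₀≈0
              (suc j) → begin
                a (suc j)
                  ≈⟨ solve 2 (λ y x → y := con (+ 0) :* x :+ y) refl (a (suc j)) (dual j m) ⟩
                0# * dual j m + a (suc j)
                  ≈⟨ +-cong (*-congʳ a₀≈0) (dual-lincomb (a ∘ suc) j) ⟨
                a zero * dual j m + dual j (lincomb (a ∘ suc) Λ)
                  ≈⟨ trans (Dual.homo-+ j _ _) (+-congʳ (Dual.homo-* j _ _)) ⟨
                dual j (lincomb a (m ∷ Λ))
                  ≈⟨ trans (Dual.cong j h) (Dual.homo-0 j) ⟩
                0# ∎
            where
            a₀≈0 : a zero ≈ 0#
            a₀≈0 = x*y≈0⇒y≈0 β≉0 (begin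
              coefficient i₀ β * a zero
                ≈⟨ solve 2 (λ b a → b :* a := a :* b :+ con (+ 0)) refl (coefficient i₀ β) (a zero) ⟩
              a zero * coefficient i₀ β + 0#
                ≈⟨ +-cong (*-congˡ (trans (level i₀ i₀∈S) (*-identityˡ _)))
                     (coefficient-lincomb-Λ (a ∘ suc) i₀ i₀∈S) ⟨
              a zero * coefficient i₀ m + coefficient i₀ (lincomb (a ∘ suc) Λ)
                ≈⟨ trans (Coefficient.homo-+ i₀ _ _) (+-congʳ (Coefficient.homo-* i₀ _ _)) ⟨
              coefficient i₀ (lincomb a (m ∷ Λ))
                ≈⟨ trans (Coefficient.cong i₀ h) (Coefficient.homo-0 i₀) ⟩
              0# ∎)

          coordinates-expansion : ∀ z {γ} → HasLevel (fromℤ z) γ → γ ≈ᴹ lincomb (coordinates z γ) (m ∷ Λ)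
          coordinates-expansion z {γ} hγ = ≈ᴹ-trans
            (coefficient-ext (λ i → sym (trans (Coefficient.homo-+ i _ _)
              (trans (+-congˡ (Coefficient.homo-- i _ _))
              (solve 2 (λ x y → y :+ (x :- y) := x) refl (coefficient i γ) (coefficient i (fromℤ z *ₗ m)))))))
            (+ᴹ-congˡ (Λ-expansion (level-0 (level--same hγ
              (level-≈ (*-identityʳ _) (level-* (fromℤ z) level))))))

          dual-rest : ∀ z γ j → dual j (rest z γ) ≈ dual j γ + - (fromℤ z * dual j m)
          dual-rest z γ j = trans (Dual.homo-- j _ _) (+-congˡ (-‿cong (Dual.homo-* j _ _)))

          -- The level dictates the sign: `least` settles positive levels, `least` for `-ᴹ γ`
          -- settles negative ones, and at level 0 only the Λ-coordinates remain, which share a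
          -- sign.
          coordinates-same-sign : ∀ z {γ} → γ ∈ Φ → HasLevel (fromℤ z) γ →
            (∀ i → 0# ≤ coordinates z γ i) ⊎ (∀ i → coordinates z γ i ≤ 0#)
          coordinates-same-sign (+ zero) {γ} γ∈Φ hγ = go (Λ-same-sign γ∈Φ (level-0 hγ))
            where
            dual-rest-0 : ∀ j → dual j γ ≈ dual j (rest (+ 0) γ)
            dual-rest-0 j = sym (trans (dual-rest (+ 0) γ j)
              (solve 2 (λ g d → g :- con (+ 0) :* d := g) refl (dual j γ) (dual j m)))
            go : (∀ j → 0# ≤ dual j γ) ⊎ (∀ j → dual j γ ≤ 0#) →
                 (∀ i → 0# ≤ coordinates (+ 0) γ i) ⊎ (∀ i → coordinates (+ 0) γ i ≤ 0#)
            go (inj₁ ≥0) = inj₁ λ { zero → ≤-refl ; (suc j) → ≤-respʳ-≈ (dual-rest-0 j) (≥0 j) }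
            go (inj₂ ≤0) = inj₂ λ { zero → ≤-refl ; (suc j) → ≤-respˡ-≈ (dual-rest-0 j) (≤0 j) }
          coordinates-same-sign (+ suc z) {γ} γ∈Φ hγ = inj₁ λ where
            zero    → fromℕ-nonNeg (suc z)
            (suc j) → ≤-respʳ-≈ (sym (dual-rest (+ suc z) γ j)) (x≤y⇒0≤y-x (least z γ∈Φ hγ j))
          coordinates-same-sign -[1+ z ] {γ} γ∈Φ hγ = inj₂ nonPos
            where
            -γ-level : HasLevel (fromℤ (+ suc z)) (-ᴹ γ)
            -γ-level = level-≈ (solve 1 (λ x → :- (:- x) := x) refl (fromℤ (+ suc z))) (level-neg hγ)
            nonPos : ∀ i → coordinates -[1+ z ] γ i ≤ 0#
            nonPos zero    = neg-nonPos (fromℕ-nonNeg (suc z))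
            nonPos (suc j) = 0≤y-x⇒x≤y (≤-respʳ-≈ (begin
                dual j (-ᴹ γ) + - (fromℤ (+ suc z) * dual j m)
                  ≈⟨ +-congʳ (Dual.homo-neg j γ) ⟩
                - dual j γ + - (fromℤ (+ suc z) * dual j m)
                  ≈⟨ solve 3 (λ g s d → :- g :- s :* d := con (+ 0) :- (g :- (:- s) :* d)) refl
                       (dual j γ) (fromℤ (+ suc z)) (dual j m) ⟩
                0# + - (dual j γ + - (fromℤ -[1+ z ] * dual j m))
                  ≈⟨ +-congˡ (-‿cong (dual-rest -[1+ z ] γ j)) ⟨
                0# + - dual j (rest -[1+ z ] γ) ∎)
              (x≤y⇒0≤y-x (least z (neg-∈ γ∈Φ) -γ-level j)))

        extremal-isSimpleSystem : IsSimpleSystem Φ[S,ℤβ] (m ∷ Λ)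
        extremal-isSimpleSystem = record
          { root        = λ where
              zero    → level⇒ℤslice root (+ 1) (level-≈ (sym (+-identityʳ 1#)) level)
              (suc j) → level⇒ℤslice (Λ-root j) (+ 0) (level-Λ j)
          ; independent = extremal-independent
          ; coord       = λ {γ} (_ , z , _) → coordinates z γ
          ; expansion   = λ γ∈ → coordinates-expansion (proj₁ (proj₂ γ∈)) (ℤslice⇒level γ∈)
          ; same-sign   = λ γ∈ → coordinates-same-sign (proj₁ (proj₂ γ∈)) (proj₁ γ∈) (ℤslice⇒level γ∈)
          }

    -- Turns the simple system of `M` and the negatives of Π ∖ S into that of `-ᴹ M` and Π ∖ S. The
    -- families are related up to `≈ᴹ` because double negation is not the identity definitionally.
    opposite-isSimpleSystem : ∀ {k} {Δ Δ′ : Vector Carrierᴹ k} → (∀ i → Δ′ i ≈ᴹ -ᴹ Δ i) →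
      (∀ i → Δ′ i ∈ Φ[S,ℤβ]) → IsSimpleSystem Φ[S,ℤβ] Δ → IsSimpleSystem Φ[S,ℤβ] Δ′
    opposite-isSimpleSystem {k} {Δ} {Δ′} Δ′≈-Δ Δ′-root simple = record
      { root        = Δ′-root
      ; independent = λ a h i → trans (solve 1 (λ x → x := :- (:- x)) refl (a i))
          (trans (-‿cong (independent (λ i → - a i) (≈ᴹ-trans (neg-lincomb a) h) i)) -0≈0)
      ; coord       = λ γ∈ i → - coord γ∈ i
      ; expansion   = λ γ∈ → ≈ᴹ-trans (expansion γ∈) (≈ᴹ-trans
          (lincomb-cong (λ i → solve 1 (λ x → x := :- (:- x)) refl (coord γ∈ i)) (λ _ → ≈ᴹ-refl))
          (neg-lincomb (λ i → - coord γ∈ i)))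
      ; same-sign   = λ γ∈ → neg-same-sign (same-sign γ∈)
      }
      where
      open IsSimpleSystem simple
      module Sumᴹ = Sum +ᴹ-commutativeMonoid
      -0≈0 : - 0# ≈ 0#
      -0≈0 = solve 0 (:- con (+ 0) := con (+ 0)) refl
      neg-lincomb : ∀ a → lincomb (λ i → - a i) Δ ≈ᴹ lincomb a Δ′
      neg-lincomb a = Sumᴹ.sum-cong-≋ λ i → ≈ᴹ-trans
        (*ₗ-congˡ (≈ᴹ-sym (≈ᴹ-trans (-ᴹ‿cong (Δ′≈-Δ i)) (-ᴹ-involutive (Δ i)))))
        (neg-*ₗ-neg (a i) (Δ′ i))

    min-isSimpleSystem : ∀ m → m ∈ Simple.IsMin Φ[S,β] → IsSimpleSystem Φ[S,ℤβ] (m ∷ Π ∖ S)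
    min-isSimpleSystem m min = extremal-isSimpleSystem Π∖S-basis (min⇒extremal min)

    max-isSimpleSystem : ∀ M → M ∈ Simple.IsMax Φ[S,β] → IsSimpleSystem Φ[S,ℤβ] (-ᴹ M ∷ Π ∖ S)
    max-isSimpleSystem M max = opposite-isSimpleSystem
      (λ where
        zero    → ≈ᴹ-refl
        (suc j) → ≈ᴹ-sym (-ᴹ-involutive (Π∖S j)))
      (λ where
        zero    → ℤslice-neg (root zero)
        (suc j) → level⇒ℤslice (LeviBasis.Λ-root Π∖S-basis j) (+ 0) (B⁺.level-Λ j))
      simple
      where
      simple : IsSimpleSystem Φ[S,ℤβ] (M ∷ (λ j → -ᴹ Π∖S j))
      simple = extremal-isSimpleSystem (opposite Π∖S-basis) (max⇒extremal max)
      open IsSimpleSystem simple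

    module _ {x t} (hx : HasLevel t x) (t≉0 : t ≉ 0#) (simple : IsSimpleSystem Φ[S,ℤβ] (x ∷ Π ∖ S)) where

      open IsSimpleSystem simple

      abstract
        -- `simple` is arbitrary, so its `coord` is known through `expansion` alone. Reading that
        -- expansion at an index in S removes Π ∖ S and leaves the head, here of level `t`, which is
        -- 1 for the minimum and -1 for the negated maximum.
        coefficient-head : ∀ {γ} (γ∈ : γ ∈ Φ[S,ℤβ]) i → i ∈ˢ S →
                           coefficient i γ ≈ coord γ∈ zero * coefficient i x
        coefficient-head {γ} γ∈ i i∈S = begin
          coefficient i γ
            ≈⟨ Coefficient.cong i (expansion γ∈) ⟩
          coefficient i (lincomb (coord γ∈) (x ∷ Π ∖ S))
            ≈⟨ trans (Coefficient.homo-+ i _ _) (+-congʳ (Coefficient.homo-* i _ _)) ⟩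
          coord γ∈ zero * coefficient i x + coefficient i (lincomb (coord γ∈ ∘ suc) (Π ∖ S))
            ≈⟨ +-congˡ (B⁺.coefficient-lincomb-Λ (coord γ∈ ∘ suc) i i∈S) ⟩
          coord γ∈ zero * coefficient i x + 0#
            ≈⟨ +-identityʳ _ ⟩
          coord γ∈ zero * coefficient i x ∎

        x≉0 : coefficient i₀ x ≉ 0#
        x≉0 ≈0 = β≉0 (x*y≈0⇒y≈0 t≉0 (trans (sym (hx i₀ i₀∈S)) ≈0))

        level⇒coord≈1 : ∀ {γ} (γ∈ : γ ∈ Φ[S,ℤβ]) → HasLevel t γ → coord γ∈ zero ≈ 1#
        level⇒coord≈1 {γ} γ∈ hγ = *-cancelˡ x≉0 (begin
          coefficient i₀ x * coord γ∈ zero   ≈⟨ *-comm _ _ ⟩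
          coord γ∈ zero * coefficient i₀ x   ≈⟨ coefficient-head γ∈ i₀ i₀∈S ⟨
          coefficient i₀ γ                   ≈⟨ trans (hγ i₀ i₀∈S) (sym (hx i₀ i₀∈S)) ⟩
          coefficient i₀ x                   ≈⟨ *-identityʳ _ ⟨
          coefficient i₀ x * 1#              ∎)

        level⇒head-slice : ∀ {γ} → γ ∈ Φ[S,ℤβ] → HasLevel t γ → γ ∈ Slice ⁅ zero ⁆ (root zero)
        level⇒head-slice γ∈ hγ = γ∈ , λ i i∈ → at i (x∈⁅y⁆⇒x≡y zero i∈)
          where
          at : ∀ i → i ≡ zero → coord γ∈ i ≈ coord (root zero) i
          at .zero ≡.refl = trans (level⇒coord≈1 γ∈ hγ) (sym (level⇒coord≈1 (root zero) hx))

        head-slice⇒level : ∀ {γ} → γ ∈ Slice ⁅ zero ⁆ (root zero) → HasLevel t γ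
        head-slice⇒level {γ} (γ∈ , h) i i∈S = begin
          coefficient i γ                    ≈⟨ coefficient-head γ∈ i i∈S ⟩
          coord γ∈ zero * coefficient i x    ≈⟨ *-congʳ (trans (h zero (x∈⁅x⁆ zero)) (level⇒coord≈1 (root zero) hx)) ⟩
          1# * coefficient i x               ≈⟨ *-identityˡ _ ⟩
          coefficient i x                    ≈⟨ hx i i∈S ⟩
          t * coefficient i β                ∎

    slice⊆ℤslice : Φ[S,β] ⊆ Φ[S,ℤβ]
    slice⊆ℤslice γ∈ = level⇒ℤslice (proj₁ γ∈) (+ 1) (level-≈ (sym (+-identityʳ 1#)) (slice⇒level γ∈))

    slice≐min-slice : ∀ m → m ∈ Simple.IsMin Φ[S,β] → (simple : IsSimpleSystem Φ[S,ℤβ] (m ∷ Π ∖ S)) →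
      Φ[S,β] ≐ IsSimpleSystem.Slice simple ⁅ zero ⁆ (IsSimpleSystem.root simple zero)
    slice≐min-slice m (m∈ , _) simple =
        (λ γ∈ → level⇒head-slice hm 1≉0 simple (slice⊆ℤslice γ∈) (slice⇒level γ∈))
      , (λ γ∈ → level⇒slice (proj₁ (proj₁ γ∈)) (head-slice⇒level hm 1≉0 simple γ∈))
      where
      hm : HasLevel 1# m
      hm = slice⇒level m∈
      1≉0 : 1# ≉ 0#
      1≉0 = 0≉1 ∘ sym

    -- The head `-ᴹ M` has level -1, so its coordinate equals 1 exactly at level -1, and negation
    -- carries that level to Φ[S,β].
    slice≐neg-max-slice : ∀ M → M ∈ Simple.IsMax Φ[S,β] → (simple : IsSimpleSystem Φ[S,ℤβ] (-ᴹ M ∷ Π ∖ S)) →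
      Φ[S,β] ≐ Neg (IsSimpleSystem.Slice simple ⁅ zero ⁆ (IsSimpleSystem.root simple zero))
    slice≐neg-max-slice M (M∈ , _) simple =
        (λ γ∈ → level⇒head-slice h-M -1≉0 simple (ℤslice-neg (slice⊆ℤslice γ∈)) (level-neg (slice⇒level γ∈)))
      , (λ {γ} γ∈ → level⇒slice (∈-resp (-ᴹ-involutive γ) (neg-∈ (proj₁ (proj₁ γ∈))))
          (level-≈ neg-neg-1 (level-resp (-ᴹ-involutive γ) (level-neg (head-slice⇒level h-M -1≉0 simple γ∈)))))
      where
      neg-neg-1 : - - 1# ≈ 1#
      neg-neg-1 = solve 1 (λ x → :- (:- x) := x) refl 1#
      h-M : HasLevel (- 1#) (-ᴹ M)
      h-M = level-neg (slice⇒level M∈)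
      -1≉0 : - 1# ≉ 0#
      -1≉0 -1≈0 = 0≉1 (sym (trans (sym neg-neg-1)
        (trans (-‿cong -1≈0) (solve 0 (:- con (+ 0) := con (+ 0)) refl))))

proposition4p2 :
    ∀ {c ℓ₁ ℓ₂ e ℓ p : Level} (K : OrderedField c ℓ₁ ℓ₂) (E : EuclideanSpace K e ℓ) →
    let open OrderedField K using (_≈_)
        open EuclideanSpace E
        open RootSystems E
        open IsSimpleSystem
    in
    (Φ : Pred Carrierᴹ p) → IsRootSystem Φ → Spanning Φ → Irreducible Φ →
    (n : ℕ) (Π : Vector Carrierᴹ n) (Π-simple : IsSimpleSystem Φ Π) →
    (S : Subset n) (β : Carrierᴹ) (β∈Φ⁺ : β ∈ Positive Π-simple) →
    ∃ (λ i → i ∈ Supp Π-simple (proj₁ β∈Φ⁺) × i ∈ˢ S) →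
    let Φ[S,β]  = Slice Π-simple S (proj₁ β∈Φ⁺)
        Φ[S,ℤβ] = ℤSlice Π-simple S (proj₁ β∈Φ⁺)
        IsMinimum = IsMin Π-simple Φ[S,β]
        IsMaximum = IsMax Π-simple Φ[S,β]
    in
    IsRootSubsystem Φ[S,ℤβ] Φ
    ×
    ( IsInterval Π-simple Φ[S,β]
    × (∀ m → m ∈ IsMinimum → IsSimpleSystem Φ[S,ℤβ] (m ∷ Π ∖ S))
    × (∀ M → M ∈ IsMaximum → IsSimpleSystem Φ[S,ℤβ] (-ᴹ M ∷ Π ∖ S))
    × (∀ m M → m ∈ IsMinimum → M ∈ IsMaximum → ⟪ m , m ⟫ ≈ ⟪ M , M ⟫)
    )
    ×
    ( (∀ m → m ∈ IsMinimum → (simple : IsSimpleSystem Φ[S,ℤβ] (m ∷ Π ∖ S)) →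
         Φ[S,β] ≐ Slice simple ⁅ zero ⁆ (root simple zero))
    × (∀ M → M ∈ IsMaximum → (simple : IsSimpleSystem Φ[S,ℤβ] (-ᴹ M ∷ Π ∖ S)) →
         Φ[S,β] ≐ Neg (Slice simple ⁅ zero ⁆ (root simple zero)))
    )
proposition4p2 K E Φ isRootSystem spanning _ n Π Π-simple S β β∈Φ⁺ (i₀ , i₀∈Supp , i₀∈S) =
    ℤslice-isRootSubsystem
  , (slice-interval , min-isSimpleSystem , max-isSimpleSystem , min-max-norm)
  , (slice≐min-slice , slice≐neg-max-slice)
  where
  open Parabolic E Φ isRootSystem spanning Π Π-simple S
  open Slices β∈Φ⁺ i₀ i₀∈S i₀∈Supp
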